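{- Fix an integer $d \geq 1$. Consider the multiobjective $0$--$1$ knapsack problem with $n$ objects, feasible set $\{0,1\}^n$, weight vector $w = (1, \dots, 1) \in \mathbb{R}^n$ (to be minimized), and $d$ profit vectors $v^{(1)}, \dots, v^{(d)} \in \mathbb{R}^n$ (to be maximized), where all profit entries $v^{(i)}_j$ are chosen independently and uniformly at random from $[0,1]$. Then the expected number of Pareto-optimal solutions is $\Omega_d(n^{d-1.5})$, where the constant in $\Omega_d$ may depend on $d$ but not on $n$.
   Context: In the knapsack problem, for $x, y \in \{0,1\}^n$, $y$ dominates $x$ if $w \cdot y \leq w \cdot x$ and $v^{(i)} \cdot y \geq v^{(i)} \cdot x$ for all $i \in [d]$, with at least one of these $d+1$ inequalities strict. A feasible solution $x$ is Pareto-optimal if no feasible $y$ dominates it. -}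

module Defs where

open import Level using (0ℓ)
open import Data.Bool using (Bool; if_then_else_)
open import Data.Fin using (Fin)
import Data.Integer as ℤ
open import Data.List using (List; []; _∷_; length)
open import Data.List.Relation.Unary.All using (All)
open import Data.List.Relation.Unary.AllPairs using (AllPairs)
open import Data.List.Relation.Unary.Unique.Propositional using (Unique)
open import Data.Nat as ℕ using (ℕ)
open import Data.Product using (_×_; _,_; proj₁; proj₂; Σ-syntax; ∃-syntax)
open import Data.Rational
open import Data.Rational.Properties
open import Data.Rational.Solver using (module +-*-Solver)
open import Data.Sum using (_⊎_)
open import Data.Unit using (⊤)
open import Data.Vec using (Vec; lookup)
open import Data.Vec.Functional using (Vector; foldr)
open import Relation.Binary.PropositionalEquality using (_≡_; refl; cong)
open import Relation.Nullary using (¬_)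
open import Relation.Unary using (Pred; _⊆_)

fromℕ : ℕ → ℚ
fromℕ k = (ℤ.+ k) / 1

------------------------------------------------------------------------
-- Real numbers

-- Regular functions (Bishop's regular sequences, indexed by the
-- tolerance): approx ε is a rational within ε of the real number.

record ℝ : Set where
  constructor mkℝ
  field
    approx  : (ε : ℚ) .{{_ : Positive ε}} → ℚ
    regular : (ε δ : ℚ) .{{_ : Positive ε}} .{{_ : Positive δ}} →
              ∣ approx ε - approx δ ∣ ≤ ε + δ

open ℝ public

fromℚ : ℚ → ℝ
fromℚ q .approx _ = q
fromℚ q .regular ε δ = begin
  ∣ q - q ∣  ≡⟨ cong ∣_∣ (+-inverseʳ q) ⟩
  0ℚ         ≤⟨ <⇒≤ (positive⁻¹ (ε + δ) {{pos+pos⇒pos ε δ}}) ⟩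
  ε + δ      ∎
  where open ≤-Reasoning

0ℝ 1ℝ : ℝ
0ℝ = fromℚ 0ℚ
1ℝ = fromℚ 1ℚ

½*-positive : (ε : ℚ) .{{_ : Positive ε}} → Positive (½ * ε)
½*-positive ε = pos*pos⇒pos ½ ε

approx½ : ℝ → (ε : ℚ) .{{_ : Positive ε}} → ℚ
approx½ x ε = approx x (½ * ε) {{½*-positive ε}}

regular½ : (x : ℝ) (ε δ : ℚ) .{{_ : Positive ε}} .{{_ : Positive δ}} →
           ∣ approx½ x ε - approx½ x δ ∣ ≤ ½ * ε + ½ * δ
regular½ x ε δ =
  regular x (½ * ε) (½ * δ) {{½*-positive ε}} {{½*-positive δ}}

infixl 6 _+ℝ_

_+ℝ_ : ℝ → ℝ → ℝ
(x +ℝ y) .approx ε = approx½ x ε + approx½ y ε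
(x +ℝ y) .regular ε δ = begin
  ∣ (a + b) - (a′ + b′) ∣
    ≡⟨ cong ∣_∣ (solve 4 (λ a b a′ b′ →
         (a :+ b) :- (a′ :+ b′) := (a :- a′) :+ (b :- b′)) refl a b a′ b′) ⟩
  ∣ (a - a′) + (b - b′) ∣
    ≤⟨ ∣p+q∣≤∣p∣+∣q∣ (a - a′) (b - b′) ⟩
  ∣ a - a′ ∣ + ∣ b - b′ ∣
    ≤⟨ +-mono-≤ (regular½ x ε δ) (regular½ y ε δ) ⟩
  (½ * ε + ½ * δ) + (½ * ε + ½ * δ)
    ≡⟨ solve 2 (λ ε δ →
         (con ½ :* ε :+ con ½ :* δ) :+ (con ½ :* ε :+ con ½ :* δ) := ε :+ δ)
         refl ε δ ⟩
  ε + δ ∎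
  where
  open ≤-Reasoning
  open +-*-Solver
  a b a′ b′ : ℚ
  a  = approx½ x ε
  b  = approx½ y ε
  a′ = approx½ x δ
  b′ = approx½ y δ

infix 4 _≤ℝ_ _<ℝ_

_≤ℝ_ : ℝ → ℝ → Set
x ≤ℝ y = (ε : ℚ) .{{_ : Positive ε}} → approx x ε ≤ approx y ε + (ε + ε)

_<ℝ_ : ℝ → ℝ → Set
x <ℝ y = Σ[ ε ∈ ℚ ] Σ[ ε>0 ∈ Positive ε ]
         approx x ε {{ε>0}} + (ε + ε) < approx y ε {{ε>0}}

------------------------------------------------------------------------
-- The multiobjective knapsack problem

_·_ : ∀ {n} → Vector ℝ n → Vec Bool n → ℝ
u · x = foldr _+ℝ_ 0ℝ (λ j → if lookup x j then u j else 0ℝ)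

record Knapsack (d n : ℕ) : Set₁ where
  field
    Feasible : Pred (Vec Bool n) 0ℓ
    weight   : Vector ℝ n
    profit   : Fin d → Vector ℝ n

module _ {d n : ℕ} (K : Knapsack d n) where
  open Knapsack K

  Dominates : Vec Bool n → Vec Bool n → Set
  Dominates y x =
    weight · y ≤ℝ weight · x ×
    (∀ i → profit i · x ≤ℝ profit i · y) ×
    (weight · y <ℝ weight · x ⊎ ∃[ i ] profit i · x <ℝ profit i · y)

  ParetoOptimal : Pred (Vec Bool n) 0ℓ
  ParetoOptimal x =
    Feasible x × (∀ y → Feasible y → ¬ Dominates y x)

unitWeightKnapsack : ∀ {d n} → (Fin d → Vector ℝ n) → Knapsack d n
unitWeightKnapsack v = record
  { Feasible = λ _ → ⊤
  ; weight   = λ _ → 1ℝ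
  ; profit   = v
  }

-- The subset P of A has at least k elements.

AtLeast : {A : Set} → ℕ → Pred A 0ℓ → Set
AtLeast {A} k P = Σ[ xs ∈ List A ] length xs ≡ k × Unique xs × All P xs

------------------------------------------------------------------------
-- Lower reals: a number is given by the rationals strictly below it.

LowerReal : Set₁
LowerReal = Pred ℚ 0ℓ

infixr 7 _⊛_
infix  4 _≤ᴸ_

_≤ᴸ_ : LowerReal → LowerReal → Set
L ≤ᴸ M = L ⊆ M

-- Scaling; only meaningful for a positive factor.

_⊛_ : ℚ → LowerReal → LowerReal
(c ⊛ L) q = ∃[ p ] L p × q ≡ c * p

-- The number n^(d - 3/2), for n ≥ 1: if p ≥ 0, then p < n^(d - 3/2)
-- iff p² n³ < n^(2d).

_^[_-3/2] : ℕ → ℕ → LowerReal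
(n ^[ d -3/2]) p = p < 0ℚ ⊎ p * p * fromℕ (n ℕ.^ 3) < fromℕ (n ℕ.^ (2 ℕ.* d))

-- f ∈Ω g is f = Ω(g). A rational constant loses no generality.

infix 4 _∈Ω_

_∈Ω_ : (ℕ → LowerReal) → (ℕ → LowerReal) → Set
f ∈Ω g = ∃[ c ] 0ℚ < c × (∃[ n₀ ] ∀ n → n₀ ℕ.≤ n → c ⊛ g n ≤ᴸ f n)

------------------------------------------------------------------------
-- Expectation over independent uniform entries, i.e. integration over
-- [0,1]^(d × n)

∏ : ∀ {n} → Vector ℚ n → ℚ
∏ = foldr _*_ 1ℚ

record Box (d n : ℕ) : Set where
  field
    lo hi : Fin d → Fin n → ℚ
    0≤lo  : ∀ i j → 0ℚ ≤ lo i j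
    lo≤hi : ∀ i j → lo i j ≤ hi i j
    hi≤1  : ∀ i j → hi i j ≤ 1ℚ

open Box public

_∈ᴮ_ : ∀ {d n} → (Fin d → Vector ℝ n) → Box d n → Set
v ∈ᴮ B = ∀ i j → fromℚ (lo B i j) ≤ℝ v i j × v i j ≤ℝ fromℚ (hi B i j)

volume : ∀ {d n} → Box d n → ℚ
volume B = ∏ λ i → ∏ λ j → hi B i j - lo B i j

NonOverlapping : ∀ {d n} → Box d n → Box d n → Set
NonOverlapping B C = ∃[ i ] ∃[ j ] (hi B i j ≤ lo C i j ⊎ hi C i j ≤ lo B i j)

-- A random variable with values in ℕ, given by its superlevel sets:
-- X k v says that X takes a value ≥ k at the sample point v.

RandomVariable : ℕ → ℕ → Set₁
RandomVariable d n = ℕ → Pred (Fin d → Vector ℝ n) 0ℓ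

-- A simple function, with value k on B for each (B , k) in the list and
-- 0 elsewhere.

SimpleFunction : ℕ → ℕ → Set
SimpleFunction d n = Σ[ s ∈ List (Box d n × ℕ) ]
  AllPairs (λ b c → NonOverlapping (proj₁ b) (proj₁ c)) s

_Below_ : ∀ {d n} → SimpleFunction d n → RandomVariable d n → Set
(s , _) Below X = All (λ (B , k) → ∀ v → v ∈ᴮ B → X k v) s

integral : ∀ {d n} → SimpleFunction d n → ℚ
integral (s , _) = go s
  where
  go : ∀ {d n} → List (Box d n × ℕ) → ℚ
  go []            = 0ℚ
  go ((B , k) ∷ s) = fromℕ k * volume B + go s

-- The supremum of the integrals of the simple functions below X: the
-- lower Darboux integral. It is the Lebesgue integral of X whenever X is
-- continuous almost everywhere, in particular when X is constant on each
-- cell of a finite hyperplane arrangement.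

𝔼 : ∀ {d n} → RandomVariable d n → LowerReal
𝔼 X q = ∃[ s ] s Below X × q < integral s

#Pareto : ∀ d n → RandomVariable d n
#Pareto d n k v = AtLeast k (ParetoOptimal (unitWeightKnapsack v))

-- Write d = e + 1. A set S of objects of the form { j : Σᵢ cᵢ vᵢⱼ ≥ t } with c, t > 0
-- maximises the functional Σᵢ cᵢ (vᵢ · x) - t |x|, so it is Pareto-optimal. Fix
-- c₀ and t and let each of c₁ , … , cₑ run through n values at distance of order
-- 1/n: this gives n ^ e = n ^ (d - 1) sets, and it remains to see that each of them
-- differs from all others with probability bounded below.
--
-- For i = 1 , … , e consider the points close to the i-th axis (in the last e
-- coordinates) and at height between 0 and κ/n above the hyperplane of c. If each of
-- these e regions contains an object, c is called regular. If c and c′ are regular,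
-- choose i with ∣cᵢ - c′ᵢ∣ maximal: if cᵢ > c′ᵢ, the object in the i-th region of c is
-- selected by c but not by c′, so the sets differ. Each region has measure of order 1/n,
-- so c is regular with probability bounded below. By linearity of expectation, a
-- constant times n ^ (d - 1) ≥ n ^ (d - 3/2) Pareto-optimal sets are expected.
--
-- For the lower Darboux integral, [0,1] is cut into a number M of order n of
-- intervals per entry, and c is discarded where some object's cell meets
-- the hyperplane; as M is a large multiple of n this costs only a constant factor.

module Submission where

open import Defs

-- Finite sums, indicators and counting of words

module Counting where
  open import Data.Bool using (true; false)
  open import Data.List using (List; []; _∷_; map; length; filter; cartesianProductWith)
  open import Data.List.Properties using (map-++; map-∘; length-++; length-map)
  open import Data.List.Relation.Unary.All as ListAll using ([]; _∷_)
  open import Data.List.Relation.Unary.AllPairs using ([]; _∷_)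
  open import Data.List.Relation.Unary.Unique.Propositional using (Unique)
  open import Data.List.Relation.Unary.Unique.Propositional.Properties using (cartesianProductWith⁺)
  open import Data.Nat
  open import Data.Nat.Combinatorics using (_C_; k>n⇒nCk≡0; nCk+nC[k+1]≡[n+1]C[k+1]; nCn≡1; nCk≡nC[n∸k])
  open import Data.Nat.ListAction using (sum)
  open import Data.Nat.ListAction.Properties using (sum-++)
  open import Data.Nat.Properties
  open import Data.Nat.Solver using (module +-*-Solver)
  open import Data.Product using (_×_; _,_)
  open import Data.Vec using (Vec; []; _∷_)
  open import Data.Vec.Properties using (∷-injective)
  open import Data.Vec.Relation.Unary.All as All using (All; []; _∷_)
  open import Data.Vec.Relation.Unary.Any as Any using (Any; here; there)
  open import Relation.Binary.PropositionalEquality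
  open import Relation.Nullary using (¬_; Dec; yes; no; does; contradiction)
  open import Relation.Nullary.Decidable using (_×-dec_)
  open import Relation.Unary using (Pred; Decidable; _⊆_)
  open import Level using (0ℓ)

  ∑ : {A : Set} → List A → (A → ℕ) → ℕ
  ∑ xs f = sum (map f xs)

  𝟙 : {P : Set} → Dec P → ℕ
  𝟙 (yes _) = 1
  𝟙 (no _)  = 0

  does-true : {P : Set} (P? : Dec P) → does P? ≡ true → P
  does-true (yes p) _ = p

  does-false : {P : Set} (P? : Dec P) → does P? ≡ false → ¬ P
  does-false (no ¬p) _ = ¬p

  𝟙-yes : {P : Set} (P? : Dec P) → P → 𝟙 P? ≡ 1
  𝟙-yes (yes _) _ = refl
  𝟙-yes (no ¬p) p = contradiction p ¬p

  𝟙-× : {P Q R : Set} (P? : Dec P) (Q? : Dec Q) (R? : Dec R) →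
        (P → Q → R) → 𝟙 P? * 𝟙 Q? ≤ 𝟙 R?
  𝟙-× (no _)  _       _  _ = z≤n
  𝟙-× (yes _) (no _)  _  _ = z≤n
  𝟙-× (yes p) (yes q) R? f = ≤-reflexive (sym (𝟙-yes R? (f p q)))

  -- As `P` and `Q` exclude each other, at most one of the two products is nonzero.
  𝟙-×-⊎-× : {P P′ Q Q′ R : Set} (P? : Dec P) (P′? : Dec P′) (Q? : Dec Q) (Q′? : Dec Q′) (R? : Dec R) →
            (Q → ¬ P) → (P → P′ → R) → (Q → Q′ → R) →
            𝟙 P? * 𝟙 P′? + 𝟙 Q? * 𝟙 Q′? ≤ 𝟙 R?
  𝟙-×-⊎-× P?      P′? (no _)  Q′? R? _  f g = ≤-trans (≤-reflexive (+-identityʳ _)) (𝟙-× P? P′? R? f)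
  𝟙-×-⊎-× (yes p) P′? (yes q) Q′? R? ¬p f g = contradiction p (¬p q)
  𝟙-×-⊎-× (no _)  P′? (yes q) Q′? R? _  f g = 𝟙-× (yes q) Q′? R? g

  𝟙≤1 : {P : Set} (P? : Dec P) → 𝟙 P? ≤ 1
  𝟙≤1 (yes _) = ≤-refl
  𝟙≤1 (no _)  = z≤n

  count : {A : Set} {P : Pred A 0ℓ} → Decidable P → List A → ℕ
  count P? xs = ∑ xs (λ x → 𝟙 (P? x))

  module _ {A : Set} where

    ∑-mono : ∀ (xs : List A) {f g} → (∀ x → f x ≤ g x) → ∑ xs f ≤ ∑ xs g
    ∑-mono []       f≤g = z≤n
    ∑-mono (x ∷ xs) f≤g = +-mono-≤ (f≤g x) (∑-mono xs f≤g)

    ∑-cong : ∀ (xs : List A) {f g} → (∀ x → f x ≡ g x) → ∑ xs f ≡ ∑ xs g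
    ∑-cong []       f≡g = refl
    ∑-cong (x ∷ xs) f≡g = cong₂ _+_ (f≡g x) (∑-cong xs f≡g)

    ∑-distrib-+ : ∀ (xs : List A) f g → ∑ xs (λ x → f x + g x) ≡ ∑ xs f + ∑ xs g
    ∑-distrib-+ []       f g = refl
    ∑-distrib-+ (x ∷ xs) f g rewrite ∑-distrib-+ xs f g =
      solve 4 (λ a b c d → (a :+ b) :+ (c :+ d) := (a :+ c) :+ (b :+ d)) refl
        (f x) (g x) (∑ xs f) (∑ xs g)
      where open +-*-Solver

    ∑-*ʳ : ∀ (xs : List A) f c → ∑ xs (λ x → f x * c) ≡ ∑ xs f * c
    ∑-*ʳ []       f c = refl
    ∑-*ʳ (x ∷ xs) f c rewrite ∑-*ʳ xs f c = sym (*-distribʳ-+ c (f x) (∑ xs f))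

    ∑-*ˡ : ∀ (xs : List A) c f → ∑ xs (λ x → c * f x) ≡ c * ∑ xs f
    ∑-*ˡ xs c f = trans (∑-cong xs (λ x → *-comm c (f x)))
                        (trans (∑-*ʳ xs f c) (*-comm _ c))

    ∑-const : ∀ (xs : List A) c → ∑ xs (λ _ → c) ≡ length xs * c
    ∑-const []       c = refl
    ∑-const (x ∷ xs) c = cong (c +_) (∑-const xs c)

    ∑-zero : ∀ (xs : List A) → ∑ xs (λ _ → 0) ≡ 0
    ∑-zero xs = trans (∑-const xs 0) (*-zeroʳ (length xs))

    length-filter≡count : {P : Pred A 0ℓ} (P? : Decidable P) (xs : List A) →
                          length (filter P? xs) ≡ count P? xs
    length-filter≡count P? []       = refl
    length-filter≡count P? (x ∷ xs) with P? x
    ... | yes _ = cong suc (length-filter≡count P? xs)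
    ... | no _  = length-filter≡count P? xs

  module _ {A B : Set} where

    ∑-comm : ∀ (xs : List A) (ys : List B) (f : A → B → ℕ) →
             ∑ xs (λ x → ∑ ys (f x)) ≡ ∑ ys (λ y → ∑ xs (λ x → f x y))
    ∑-comm []       ys f = sym (∑-zero ys)
    ∑-comm (x ∷ xs) ys f rewrite ∑-comm xs ys f =
      sym (∑-distrib-+ ys (f x) (λ y → ∑ xs (λ x → f x y)))

    ∑-product : ∀ {C : Set} (_∙_ : A → B → C) xs ys (f : C → ℕ) →
                ∑ (cartesianProductWith _∙_ xs ys) f ≡ ∑ xs (λ x → ∑ ys (λ y → f (x ∙ y)))
    ∑-product _∙_ []       ys f = refl
    ∑-product _∙_ (x ∷ xs) ys f = begin
      sum (map f (map (x ∙_) ys ++ zs))           ≡⟨ cong sum (map-++ f (map (x ∙_) ys) zs) ⟩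
      sum (map f (map (x ∙_) ys) ++ map f zs)     ≡⟨ sum-++ (map f (map (x ∙_) ys)) (map f zs) ⟩
      sum (map f (map (x ∙_) ys)) + ∑ zs f        ≡⟨ cong₂ _+_ (cong sum (sym (map-∘ ys))) (∑-product _∙_ xs ys f) ⟩
      ∑ (x ∷ xs) (λ x → ∑ ys (λ y → f (x ∙ y)))   ∎
      where
      open ≡-Reasoning
      open import Data.List using (_++_)
      zs = cartesianProductWith _∙_ xs ys

    length-product : ∀ {C : Set} (_∙_ : A → B → C) xs ys →
                     length (cartesianProductWith _∙_ xs ys) ≡ length xs * length ys
    length-product _∙_ []       ys = refl
    length-product _∙_ (x ∷ xs) ys =
      trans (length-++ (map (x ∙_) ys))
            (cong₂ _+_ (length-map (x ∙_) ys) (length-product _∙_ xs ys))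

  module _ {A : Set} where

    words : ∀ n → List A → List (Vec A n)
    words zero    xs = [] ∷ []
    words (suc n) xs = cartesianProductWith _∷_ xs (words n xs)

    length-words : ∀ n xs → length (words n xs) ≡ length xs ^ n
    length-words zero    xs = refl
    length-words (suc n) xs =
      trans (length-product _∷_ xs (words n xs))
            (cong (length xs *_) (length-words n xs))

    words-unique : ∀ n {xs} → Unique xs → Unique (words n xs)
    words-unique zero    xs! = [] ∷ []
    words-unique (suc n) xs! =
      cartesianProductWith⁺ _∷_ ∷-injective xs! (words-unique n xs!)

  -- Elementary inequalities: binomial coefficients and Bernoulli

  -- A mean value bound: over a unit step, the power with exponent `suc k` grows by at most its
  -- derivative at the right end.
  [1+n]^k≤n^k+k[1+n]^[k-1] : ∀ n k → suc n ^ suc k ≤ n ^ suc k + suc k * suc n ^ k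
  [1+n]^k≤n^k+k[1+n]^[k-1] n zero = ≤-reflexive
    (solve 1 (λ n → (con 1 :+ n) :* con 1 := n :* con 1 :+ con 1) refl n)
    where open +-*-Solver
  [1+n]^k≤n^k+k[1+n]^[k-1] n (suc k) = begin
    s + n * s
      ≤⟨ +-monoʳ-≤ s (*-monoʳ-≤ n ([1+n]^k≤n^k+k[1+n]^[k-1] n k)) ⟩
    s + n * (r + suc k * t)
      ≤⟨ m≤m+n _ (suc k * t) ⟩
    s + n * (r + suc k * t) + suc k * t
      ≡⟨ solve 4 (λ n t r k → (t :+ n :* t) :+ n :* (r :+ k :* t) :+ k :* t
                    := n :* r :+ ((t :+ n :* t) :+ k :* (t :+ n :* t))) refl n t r (suc k) ⟩
    n * r + (s + suc k * s) ∎
    where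
    open ≤-Reasoning
    open +-*-Solver
    s = suc n ^ suc k
    t = suc n ^ k
    r = n ^ suc k

  nC0≡1 : ∀ n → n C 0 ≡ 1
  nC0≡1 n = trans (nCk≡nC[n∸k] {0} {n} z≤n) (nCn≡1 n)

  -- The right side is the rising product (n+1)...(n+k). The induction runs over both arguments: the
  -- mean value bound splits the power into two parts, and Pascal's rule joins the two bounds
  -- obtained for them.
  n^k≤k!*[n+k]Ck : ∀ n k → n ^ k ≤ k ! * ((n + k) C k)
  n^k≤k!*[n+k]Ck n zero = ≤-reflexive (sym (trans (+-identityʳ _)
    (nC0≡1 (n + 0))))
  n^k≤k!*[n+k]Ck zero    (suc k) = z≤n
  n^k≤k!*[n+k]Ck (suc n) (suc k) = begin
    suc n ^ suc k
      ≤⟨ [1+n]^k≤n^k+k[1+n]^[k-1] n k ⟩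
    n ^ suc k + suc k * suc n ^ k
      ≤⟨ +-mono-≤ (n^k≤k!*[n+k]Ck n (suc k)) (*-monoʳ-≤ (suc k) (n^k≤k!*[n+k]Ck (suc n) k)) ⟩
    suc k ! * ((n + suc k) C suc k) + suc k * (k ! * ((suc n + k) C k))
      ≡⟨ cong₂ _+_ refl (sym (*-assoc (suc k) (k !) _)) ⟩
    suc k ! * ((n + suc k) C suc k) + suc k ! * ((suc n + k) C k)
      ≡⟨ cong (λ m → suc k ! * ((n + suc k) C suc k) + suc k ! * (m C k)) (sym (+-suc n k)) ⟩
    suc k ! * ((n + suc k) C suc k) + suc k ! * ((n + suc k) C k)
      ≡⟨ sym (*-distribˡ-+ (suc k !) _ _) ⟩
    suc k ! * ((n + suc k) C suc k + (n + suc k) C k)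
      ≡⟨ cong (suc k ! *_) (+-comm _ ((n + suc k) C k)) ⟩
    suc k ! * ((n + suc k) C k + (n + suc k) C suc k)
      ≡⟨ cong (suc k ! *_) (nCk+nC[k+1]≡[n+1]C[k+1] (n + suc k) k) ⟩
    suc k ! * ((suc n + suc k) C suc k) ∎
    where open ≤-Reasoning

  ^-distribʳ-* : ∀ k m n → (m * n) ^ k ≡ m ^ k * n ^ k
  ^-distribʳ-* zero    m n = refl
  ^-distribʳ-* (suc k) m n rewrite ^-distribʳ-* k m n =
    solve 4 (λ m n a b → (m :* n) :* (a :* b) := (m :* a) :* (n :* b)) refl m n (m ^ k) (n ^ k)
    where open +-*-Solver

  -- Apply the preceding bound to `n ∸ k`, which is at least half of `n`.
  n^k≤2^k*k!*nCk : ∀ n k → k + k ≤ n → n ^ k ≤ 2 ^ k * (k ! * (n C k))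
  n^k≤2^k*k!*nCk n k 2k≤n = begin
    n ^ k                              ≤⟨ ^-monoˡ-≤ k n≤2m ⟩
    (2 * m) ^ k                        ≡⟨ ^-distribʳ-* k 2 m ⟩
    2 ^ k * m ^ k                      ≤⟨ *-monoʳ-≤ (2 ^ k) (n^k≤k!*[n+k]Ck m k) ⟩
    2 ^ k * (k ! * ((m + k) C k))      ≡⟨ cong (λ n → 2 ^ k * (k ! * (n C k))) m+k≡n ⟩
    2 ^ k * (k ! * (n C k))            ∎
    where
    open ≤-Reasoning
    m = n ∸ k
    m+k≡n : m + k ≡ n
    m+k≡n = m∸n+n≡m (≤-trans (m≤m+n k k) 2k≤n)
    n≤2m : n ≤ 2 * m
    n≤2m = begin
      n             ≡⟨ sym m+k≡n ⟩
      m + k         ≤⟨ +-monoʳ-≤ m (m+n≤o⇒m≤o∸n k 2k≤n) ⟩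
      m + m         ≡⟨ cong (m +_) (sym (+-identityʳ m)) ⟩
      2 * m         ∎

  -- Bernoulli's inequality (1 - x)^n ≥ 1 - n x for x = σ / (α + σ), with denominators cleared.
  bernoulli : ∀ α σ n → (α + σ) * (α + σ) ^ n ≤ (α + σ) * α ^ n + n * σ * (α + σ) ^ n
  bernoulli α σ zero    = m≤m+n _ 0
  bernoulli α σ (suc n) = begin
    T * (T * T ^ n)
      ≤⟨ *-monoʳ-≤ T (bernoulli α σ n) ⟩
    T * (T * α ^ n + n * σ * T ^ n)
      ≡⟨ solve 5 (λ α σ a n t → (α :+ σ) :* ((α :+ σ) :* a :+ n :* σ :* t)
            := (α :+ σ) :* (α :* a) :+ (σ :* ((α :+ σ) :* a) :+ n :* σ :* ((α :+ σ) :* t)))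
            refl α σ (α ^ n) n (T ^ n) ⟩
    T * (α * α ^ n) + (σ * (T * α ^ n) + n * σ * (T * T ^ n))
      ≤⟨ +-monoʳ-≤ (T * (α * α ^ n)) (+-monoˡ-≤ (n * σ * (T * T ^ n))
           (*-monoʳ-≤ σ (*-monoʳ-≤ T (^-monoˡ-≤ n (m≤m+n α σ))))) ⟩
    T * (α * α ^ n) + (σ * (T * T ^ n) + n * σ * (T * T ^ n))
      ≡⟨ cong (T * (α * α ^ n) +_) (sym (*-distribʳ-+ (T * T ^ n) σ (n * σ))) ⟩
    T * (α * α ^ n) + (suc n * σ) * (T * T ^ n) ∎
    where
    open ≤-Reasoning
    open +-*-Solver
    T = α + σ

  -- The case n x ≤ 1/2 of Bernoulli's inequality: if the share of `σ` is at most 1/(2n), then `n`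
  -- independent draws all avoid it with probability at least 1/2.
  [α+σ]^n≤2α^n : ∀ α σ n → .{{NonZero (α + σ)}} → 2 * (n * σ) ≤ α + σ → (α + σ) ^ n ≤ 2 * α ^ n
  [α+σ]^n≤2α^n α σ n 2nσ≤T = *-cancelˡ-≤ T (+-cancelʳ-≤ (T * T ^ n) _ _ (begin
    T * T ^ n + T * T ^ n
      ≤⟨ +-mono-≤ (bernoulli α σ n) (bernoulli α σ n) ⟩
    (T * α ^ n + n * σ * T ^ n) + (T * α ^ n + n * σ * T ^ n)
      ≡⟨ solve 4 (λ T a s t → (T :* a :+ s :* t) :+ (T :* a :+ s :* t)
            := T :* (con 2 :* a) :+ (con 2 :* s) :* t) refl T (α ^ n) (n * σ) (T ^ n) ⟩
    T * (2 * α ^ n) + 2 * (n * σ) * T ^ n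
      ≤⟨ +-monoʳ-≤ (T * (2 * α ^ n)) (*-monoˡ-≤ (T ^ n) 2nσ≤T) ⟩
    T * (2 * α ^ n) + T * T ^ n ∎))
    where
    open ≤-Reasoning
    open +-*-Solver
    T = α + σ

  -- Counting words that contain letters of prescribed kinds

  module _ {X I : Set} {K A : Pred X 0ℓ} {G : I → Pred X 0ℓ}
           (K? : Decidable K) (A? : Decidable A) (G? : ∀ i → Decidable (G i)) where

    -- A letter will be the grid cell of one object and a word the cells of all `n` objects. `K`
    -- will be the certain cells, `A` the far ones and `G i` the good ones of kind `i`, so that
    -- `Hits` becomes regularity.
    Hits : ∀ {n} → List I → Vec X n → Set
    Hits is w = All K w × ListAll.All (λ i → Any (G i) w) is

    hits? : ∀ {n} is (w : Vec X n) → Dec (Hits is w)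
    hits? is w = All.all? K? w ×-dec ListAll.all? (λ i → Any.any? (G? i) w) is

    module _ (A⊆K : A ⊆ K) (G⊆K : ∀ i → G i ⊆ K) (G∩A=∅ : ∀ i {x} → G i x → ¬ A x) where

      hits-∷ : ∀ {n} {is} {x} {w : Vec X n} → K x → Hits is w → Hits is (x ∷ w)
      hits-∷ cx (cw , gw) = cx ∷ cw , ListAll.map there gw

      hits-far : ∀ {n} is x (w : Vec X n) →
                 𝟙 (A? x) * 𝟙 (hits? is w) ≤ 𝟙 (hits? is (x ∷ w))
      hits-far is x w =
        𝟙-× (A? x) (hits? is w) (hits? is (x ∷ w)) (λ ax h → hits-∷ (A⊆K ax) h)

      -- A far first letter keeps whatever the tail hits; a good one supplies the kind `i` itself.
      -- No letter does both, so the two contributions may be added.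
      hits-far-or-good : ∀ {n} i is x (w : Vec X n) →
                         𝟙 (A? x) * 𝟙 (hits? (i ∷ is) w) + 𝟙 (G? i x) * 𝟙 (hits? is w)
                           ≤ 𝟙 (hits? (i ∷ is) (x ∷ w))
      hits-far-or-good i is x w =
        𝟙-×-⊎-× (A? x) (hits? (i ∷ is) w) (G? i x) (hits? is w) (hits? (i ∷ is) (x ∷ w))
          (G∩A=∅ i) (λ ax h → hits-∷ (A⊆K ax) h)
          (λ { gx (kw , gw) → G⊆K i gx ∷ kw , here gx ∷ ListAll.map there gw })

      module _ (xs : List X) {γ : ℕ} (γ≤ : ∀ i → γ ≤ count (G? i) xs) where

        private
          α = count A? xs

          #hits : ∀ n → List I → ℕ
          #hits n is = count (hits? {n} is) (words n xs)

          ∑∑-factor : ∀ n (f : X → ℕ) (g : Vec X n → ℕ) →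
                      ∑ xs (λ x → ∑ (words n xs) (λ w → f x * g w)) ≡ ∑ xs f * ∑ (words n xs) g
          ∑∑-factor n f g = trans (∑-cong xs (λ x → ∑-*ˡ (words n xs) (f x) g))
                                    (∑-*ʳ xs f (∑ (words n xs) g))

        #hits-far : ∀ n is → α * #hits n is ≤ #hits (suc n) is
        #hits-far n is = begin
          α * #hits n is
            ≡⟨ sym (∑∑-factor n (λ x → 𝟙 (A? x)) (λ w → 𝟙 (hits? is w))) ⟩
          ∑ xs (λ x → ∑ (words n xs) (λ w → 𝟙 (A? x) * 𝟙 (hits? is w)))
            ≤⟨ ∑-mono xs (λ x → ∑-mono (words n xs) (λ w → hits-far is x w)) ⟩
          ∑ xs (λ x → ∑ (words n xs) (λ w → 𝟙 (hits? is (x ∷ w))))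
            ≡⟨ sym (∑-product _∷_ xs (words n xs) _) ⟩
          #hits (suc n) is ∎
          where open ≤-Reasoning

        #hits-far-or-good : ∀ n i is →
          α * #hits n (i ∷ is) + count (G? i) xs * #hits n is ≤ #hits (suc n) (i ∷ is)
        #hits-far-or-good n i is = begin
          α * #hits n (i ∷ is) + count (G? i) xs * #hits n is
            ≡⟨ cong₂ _+_ (sym (∑∑-factor n (λ x → 𝟙 (A? x)) (λ w → 𝟙 (hits? (i ∷ is) w))))
                         (sym (∑∑-factor n (λ x → 𝟙 (G? i x)) (λ w → 𝟙 (hits? is w)))) ⟩
          ∑ xs (λ x → ∑ (words n xs) (λ w → f x w)) + ∑ xs (λ x → ∑ (words n xs) (λ w → g x w))
            ≡⟨ sym (trans (∑-cong xs (λ x → ∑-distrib-+ (words n xs) (f x) (g x))) (∑-distrib-+ xs _ _)) ⟩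
          ∑ xs (λ x → ∑ (words n xs) (λ w → f x w + g x w))
            ≤⟨ ∑-mono xs (λ x → ∑-mono (words n xs) (λ w → hits-far-or-good i is x w)) ⟩
          ∑ xs (λ x → ∑ (words n xs) (λ w → 𝟙 (hits? (i ∷ is) (x ∷ w))))
            ≡⟨ sym (∑-product _∷_ xs (words n xs) _) ⟩
          #hits (suc n) (i ∷ is) ∎
          where
          open ≤-Reasoning
          f g : X → Vec X n → ℕ
          f x w = 𝟙 (A? x) * 𝟙 (hits? (i ∷ is) w)
          g x w = 𝟙 (G? i x) * 𝟙 (hits? is w)

        α^n≤#hits[] : ∀ n → α ^ n ≤ #hits n []
        α^n≤#hits[] zero    = ≤-reflexive (sym (trans (+-identityʳ _) (𝟙-yes (hits? [] []) ([] , []))))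
        α^n≤#hits[] (suc n) = ≤-trans (*-monoʳ-≤ α (α^n≤#hits[] n)) (#hits-far n [])

        -- Only words with far letters everywhere except for one letter of each
        -- kind is, in this order, are counted: this makes the count obey
        -- Pascal's recursion.  The factors α ^ k avoid α ^ (n ∸ k).
        #hits-lower : ∀ n is → (n C length is) * γ ^ length is * α ^ n ≤ #hits n is * α ^ length is
        #hits-lower n [] = begin
          (n C 0) * 1 * α ^ n  ≡⟨ cong (λ c → c * 1 * α ^ n) (nC0≡1 n) ⟩
          1 * 1 * α ^ n        ≡⟨ *-identityˡ (α ^ n) ⟩
          α ^ n                ≤⟨ α^n≤#hits[] n ⟩
          #hits n []           ≡⟨ sym (*-identityʳ _) ⟩
          #hits n [] * 1       ∎
          where open ≤-Reasoning
        #hits-lower zero (i ∷ is) = begin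
          (0 C k) * γ ^ k * 1  ≡⟨ cong (λ c → c * γ ^ k * 1) (k>n⇒nCk≡0 {0} {k} z<s) ⟩
          0                    ≤⟨ z≤n ⟩
          #hits 0 (i ∷ is) * α ^ k ∎
          where
          open ≤-Reasoning
          k = length (i ∷ is)
        #hits-lower (suc n) (i ∷ is) = begin
          (suc n C suc k) * (γ * γ ^ k) * (α * α ^ n)
            ≡⟨ cong (λ c → c * (γ * γ ^ k) * (α * α ^ n)) (sym (nCk+nC[k+1]≡[n+1]C[k+1] n k)) ⟩
          ((n C k) + (n C suc k)) * (γ * γ ^ k) * (α * α ^ n)
            ≡⟨ solve 6 (λ c c' γ g α a → (c :+ c') :* (γ :* g) :* (α :* a)
                  := α :* (c' :* (γ :* g) :* a) :+ γ :* α :* (c :* g :* a))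
                  refl (n C k) (n C suc k) γ (γ ^ k) α (α ^ n) ⟩
          α * ((n C suc k) * (γ * γ ^ k) * α ^ n) + γ * α * ((n C k) * γ ^ k * α ^ n)
            ≤⟨ +-mono-≤ (*-monoʳ-≤ α (#hits-lower n (i ∷ is)))
                 (*-mono-≤ (*-monoˡ-≤ α (γ≤ i)) (#hits-lower n is)) ⟩
          α * (#hits n (i ∷ is) * (α * α ^ k)) + count (G? i) xs * α * (#hits n is * α ^ k)
            ≡⟨ solve 5 (λ α h a c h' → α :* (h :* (α :* a)) :+ c :* α :* (h' :* a)
                  := (α :* h :+ c :* h') :* (α :* a))
                  refl α (#hits n (i ∷ is)) (α ^ k) (count (G? i) xs) (#hits n is) ⟩
          (α * #hits n (i ∷ is) + count (G? i) xs * #hits n is) * (α * α ^ k)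
            ≤⟨ *-monoˡ-≤ (α * α ^ k) (#hits-far-or-good n i is) ⟩
          #hits (suc n) (i ∷ is) * (α * α ^ k) ∎
          where
          open ≤-Reasoning
          open +-*-Solver
          k = length is

        -- With T letters in all and k kinds, (α / T)^n ≥ 1/2 by Bernoulli. Up to constants, the
        -- number of positions for the k good letters is n^k, and each kind has a share γ / T ≥ 1 /
        -- (n R). The powers of `n` cancel, which leaves a fraction independent of `n`.
        #hits-constant-fraction : ∀ n is R σ → .{{NonZero (length xs)}} → .{{NonZero n}} →
          α + σ ≡ length xs → 2 * (n * σ) ≤ length xs → length xs ≤ n * R * γ →
          length is + length is ≤ n →
          length xs ^ n ≤ 2 * (2 ^ length is * length is ! * R ^ length is) * #hits n is
        #hits-constant-fraction n is R σ {{T≢0}} α+σ≡T 2nσ≤T T≤nRγ 2k≤n = begin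
          T ^ n
            ≤⟨ T^n≤2α^n ⟩
          2 * α ^ n
            ≤⟨ *-monoʳ-≤ 2 (*-cancelˡ-≤ (n ^ k * γ ^ k) core) ⟩
          2 * (2 ^ k * k ! * R ^ k * h)
            ≡⟨ sym (*-assoc 2 (2 ^ k * k ! * R ^ k) h) ⟩
          2 * (2 ^ k * k ! * R ^ k) * h ∎
          where
          open ≤-Reasoning
          open +-*-Solver
          T = length xs
          k = length is
          h = #hits n is
          T^n≤2α^n : T ^ n ≤ 2 * α ^ n
          T^n≤2α^n = subst (λ T → T ^ n ≤ 2 * α ^ n) α+σ≡T
            ([α+σ]^n≤2α^n α σ n {{subst NonZero (sym α+σ≡T) T≢0}}
              (subst (2 * (n * σ) ≤_) (sym α+σ≡T) 2nσ≤T))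
          -- For `γ` equal to 0 the bound `T ≤ n * R * γ` would make the alphabet empty.
          γ≢0 : NonZero γ
          γ≢0 = ≢-nonZero (λ γ≡0 → contradiction
            (n≤0⇒n≡0 (subst (T ≤_) (*-zeroʳ (n * R)) (subst (λ γ → T ≤ n * R * γ) γ≡0 T≤nRγ)))
            (≢-nonZero⁻¹ T))
          instance
            _ = m*n≢0 (n ^ k) (γ ^ k) {{m^n≢0 n k}} {{m^n≢0 γ k {{γ≢0}}}}
          α≤T : α ≤ T
          α≤T = ≤-trans (m≤m+n α σ) (≤-reflexive α+σ≡T)
          core : n ^ k * γ ^ k * α ^ n ≤ n ^ k * γ ^ k * (2 ^ k * k ! * R ^ k * h)
          core = begin
            n ^ k * γ ^ k * α ^ n
              ≤⟨ *-monoˡ-≤ (α ^ n) (*-monoˡ-≤ (γ ^ k) (n^k≤2^k*k!*nCk n k 2k≤n)) ⟩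
            2 ^ k * (k ! * (n C k)) * γ ^ k * α ^ n
              ≡⟨ solve 5 (λ a b c g α → a :* (b :* c) :* g :* α := a :* b :* (c :* g :* α)) refl
                    (2 ^ k) (k !) (n C k) (γ ^ k) (α ^ n) ⟩
            2 ^ k * k ! * ((n C k) * γ ^ k * α ^ n)
              ≤⟨ *-monoʳ-≤ (2 ^ k * k !) (#hits-lower n is) ⟩
            2 ^ k * k ! * (h * α ^ k)
              -- The factor `α ^ k` left over by `#hits-lower` is at most `(n * R * γ) ^ k`; this
              -- produces the common factor `n ^ k * γ ^ k` to be cancelled.
              ≤⟨ *-monoʳ-≤ (2 ^ k * k !) (*-monoʳ-≤ h (^-monoˡ-≤ k (≤-trans α≤T T≤nRγ))) ⟩
            2 ^ k * k ! * (h * (n * R * γ) ^ k)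
              ≡⟨ cong (λ z → 2 ^ k * k ! * (h * z))
                   (trans (^-distribʳ-* k (n * R) γ) (cong (_* γ ^ k) (^-distribʳ-* k n R))) ⟩
            2 ^ k * k ! * (h * (n ^ k * R ^ k * γ ^ k))
              ≡⟨ solve 5 (λ a h n r g → a :* (h :* (n :* r :* g)) := n :* g :* (a :* r :* h)) refl
                    (2 ^ k * k !) h (n ^ k) (R ^ k) (γ ^ k) ⟩
            n ^ k * γ ^ k * (2 ^ k * k ! * R ^ k * h) ∎

-- Natural numbers as rationals

module Embedding where
  open import Data.Integer as ℤ using (+_)
  import Data.Integer.Properties as ℤ
  open import Data.Nat as ℕ using (ℕ)
  import Data.Nat.Coprimality as Coprimality
  open import Data.Rational
  open import Data.Rational.Properties
  open import Relation.Binary.PropositionalEquality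

  private
    -- `fromℕ k` in explicit lowest terms, so that order, sums and products unfold to integer
    -- arithmetic.
    whole : ℕ → ℚ
    whole k = mkℚ (+ k) 0 (Coprimality.sym (Coprimality.1-coprimeTo k))

    fromℕ≡whole : ∀ k → fromℕ k ≡ whole k
    fromℕ≡whole k = normalize-coprime (Coprimality.sym (Coprimality.1-coprimeTo k))

  fromℕ-+ : ∀ m n → fromℕ (m ℕ.+ n) ≡ fromℕ m + fromℕ n
  fromℕ-+ m n = sym (trans (cong₂ _+_ (fromℕ≡whole m) (fromℕ≡whole n))
    (cong (λ i → i / 1) (cong₂ ℤ._+_ (ℤ.*-identityʳ (+ m)) (ℤ.*-identityʳ (+ n)))))

  fromℕ-* : ∀ m n → fromℕ (m ℕ.* n) ≡ fromℕ m * fromℕ n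
  fromℕ-* m n = sym (trans (cong₂ _*_ (fromℕ≡whole m) (fromℕ≡whole n))
    (cong (λ i → i / 1) (sym (ℤ.pos-* m n))))

  fromℕ-mono-≤ : ∀ {m n} → m ℕ.≤ n → fromℕ m ≤ fromℕ n
  fromℕ-mono-≤ {m} {n} m≤n = subst₂ _≤_ (sym (fromℕ≡whole m)) (sym (fromℕ≡whole n))
    (*≤* (ℤ.*-monoʳ-≤-nonNeg (+ 1) (ℤ.+≤+ m≤n)))

  fromℕ-nonNegative : ∀ n → NonNegative (fromℕ n)
  fromℕ-nonNegative n = normalize-nonNeg n 1

  fromℕ-positive : ∀ n → .{{ℕ.NonZero n}} → Positive (fromℕ n)
  fromℕ-positive n = normalize-pos n 1

-- Rational approximation of real numbers

module Certificate where
  open import Data.Bool using (Bool; true; false; if_then_else_)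
  open import Data.Empty using (⊥)
  open import Data.Fin using (Fin; zero; suc; _≟_)
  open import Data.Nat as ℕ using (ℕ; zero; suc)
  open import Data.Product using (_×_; _,_; proj₁; proj₂; ∃-syntax; Σ-syntax)
  open import Data.Rational hiding (_≟_)
  open import Data.Rational.Properties hiding (_≟_)
  open import Data.Rational.Solver using (module +-*-Solver)
  open import Data.Sum using (inj₁; inj₂)
  open import Data.Unit using (tt)
  open import Data.Vec using (Vec; []; _∷_; lookup)
  open import Data.Vec.Functional using (Vector)
  open import Relation.Binary.PropositionalEquality
  open import Relation.Nullary using (¬_; yes; no; contradiction)
  open import Algebra.Bundles using (CommutativeRing)
  open import Algebra.Properties.Semiring.Sum (CommutativeRing.semiring +-*-commutativeRing)
    using (sum; sum-cong-≗; sum-replicate-zero; ∑-comm; *-distribˡ-sum; ∑-distrib-+)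
  open Embedding

  ∣p-q∣≤r⇒p≤q+r : ∀ {p q r} → ∣ p - q ∣ ≤ r → p ≤ q + r
  ∣p-q∣≤r⇒p≤q+r {p} {q} {r} ∣p-q∣≤r = begin
    p            ≡⟨ solve 2 (λ p q → p := q :+ (p :- q)) refl p q ⟩
    q + (p - q)  ≤⟨ +-monoʳ-≤ q (p≤∣p∣ (p - q)) ⟩
    q + ∣ p - q ∣ ≤⟨ +-monoʳ-≤ q ∣p-q∣≤r ⟩
    q + r        ∎
    where
    open ≤-Reasoning
    open +-*-Solver
    p≤∣p∣ : ∀ p → p ≤ ∣ p ∣
    p≤∣p∣ p with ≤-total 0ℚ p
    ... | inj₁ 0≤p = ≤-reflexive (sym (0≤p⇒∣p∣≡p 0≤p))
    ... | inj₂ p≤0 = ≤-trans p≤0 (0≤∣p∣ p)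

  regular-≤ : ∀ x ε δ .{{_ : Positive ε}} .{{_ : Positive δ}} → approx x ε ≤ approx x δ + (ε + δ)
  regular-≤ x ε δ = ∣p-q∣≤r⇒p≤q+r (regular x ε δ)

  -- This says that the distance of `x` and `q` is at most `η`; the summand `δ` is the tolerance of
  -- the approximation that stands in for `x`.
  Near : ℝ → ℚ → ℚ → Set
  Near x q η = ∀ δ .{{_ : Positive δ}} → approx x δ ≤ q + (δ + η) × q ≤ approx x δ + (δ + η)

  Near-weaken : ∀ {x q η θ} → η ≤ θ → Near x q η → Near x q θ
  Near-weaken {x} {q} η≤θ x≈q δ =
    ≤-trans (proj₁ (x≈q δ)) (+-monoʳ-≤ q (+-monoʳ-≤ δ η≤θ)) ,
    ≤-trans (proj₂ (x≈q δ)) (+-monoʳ-≤ (approx x δ) (+-monoʳ-≤ δ η≤θ))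

  Near-fromℚ : ∀ q {η} → 0ℚ ≤ η → Near (fromℚ q) q η
  Near-fromℚ q {η} 0≤η δ = q≤q+ , q≤q+
    where
    q≤q+ : q ≤ q + (δ + η)
    q≤q+ = ≤-trans (≤-reflexive (sym (+-identityʳ q)))
      (+-monoʳ-≤ q (+-mono-≤ (<⇒≤ (positive⁻¹ δ)) 0≤η))

  Near-+ : ∀ {x y p q η θ} → Near x p η → Near y q θ → Near (x +ℝ y) (p + q) (η + θ)
  Near-+ {x} {y} {p} {q} {η} {θ} x≈p y≈q δ =
    bound (approx½ x δ) p (approx½ y δ) q (x≤ .proj₁) (y≤ .proj₁) ,
    bound p (approx½ x δ) q (approx½ y δ) (x≤ .proj₂) (y≤ .proj₂)
    where
    open +-*-Solver
    x≤ = x≈p (½ * δ) {{½*-positive δ}}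
    y≤ = y≈q (½ * δ) {{½*-positive δ}}
    bound : ∀ a b c d → a ≤ b + (½ * δ + η) → c ≤ d + (½ * δ + θ) → a + c ≤ (b + d) + (δ + (η + θ))
    bound a b c d a≤ c≤ = ≤-trans (+-mono-≤ a≤ c≤) (≤-reflexive
      (solve 5 (λ b d δ η θ → (b :+ (con ½ :* δ :+ η)) :+ (d :+ (con ½ :* δ :+ θ))
         := (b :+ d) :+ (δ :+ (η :+ θ))) refl b d δ η θ))

  η≤3η : ∀ η .{{_ : Positive η}} → η ≤ fromℕ 3 * η
  η≤3η η = ≤-trans (≤-reflexive (sym (*-identityˡ η)))
    (*-monoʳ-≤-nonNeg η {{pos⇒nonNeg η}} (fromℕ-mono-≤ {1} {3} (ℕ.s≤s ℕ.z≤n)))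

  -- `q` is `approx x η` clamped to the interval. The approximation itself may fall outside, where
  -- conditions imposed at the corners of a box say nothing. Clamping costs 2η through the
  -- inequality of reals, and passing to tolerance `δ` costs another η.
  Near-interval : ∀ {x l h} η .{{_ : Positive η}} → l ≤ h → fromℚ l ≤ℝ x → x ≤ℝ fromℚ h →
                  ∃[ q ] l ≤ q × q ≤ h × Near x q (fromℕ 3 * η)
  Near-interval {x} {l} {h} η l≤h l≤x x≤h with ≤-total (approx x η) l | ≤-total h (approx x η)
  ... | inj₁ x≤l | _ = l , ≤-refl , l≤h , λ δ →
      (begin
        approx x δ            ≤⟨ regular-≤ x δ η ⟩
        approx x η + (δ + η)  ≤⟨ +-monoˡ-≤ (δ + η) x≤l ⟩
        l + (δ + η)           ≤⟨ +-monoʳ-≤ l (+-monoʳ-≤ δ (η≤3η η)) ⟩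
        l + (δ + fromℕ 3 * η) ∎)
      , (begin
        l                                 ≤⟨ l≤x η ⟩
        approx x η + (η + η)              ≤⟨ +-monoˡ-≤ (η + η) (regular-≤ x η δ) ⟩
        approx x δ + (η + δ) + (η + η)    ≡⟨ solve 3 (λ a η δ → a :+ (η :+ δ) :+ (η :+ η)
                                               := a :+ (δ :+ con (fromℕ 3) :* η)) refl (approx x δ) η δ ⟩
        approx x δ + (δ + fromℕ 3 * η)    ∎)
    where
    open ≤-Reasoning
    open +-*-Solver
  ... | inj₂ l≤x′ | inj₁ h≤x = h , l≤h , ≤-refl , λ δ →
      (begin
        approx x δ                          ≤⟨ regular-≤ x δ η ⟩
        approx x η + (δ + η)                ≤⟨ +-monoˡ-≤ (δ + η) (x≤h η) ⟩
        h + (η + η) + (δ + η)               ≡⟨ solve 3 (λ a η δ → a :+ (η :+ η) :+ (δ :+ η)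
                                               := a :+ (δ :+ con (fromℕ 3) :* η)) refl h η δ ⟩
        h + (δ + fromℕ 3 * η)               ∎)
      , (begin
        h                              ≤⟨ h≤x ⟩
        approx x η                     ≤⟨ regular-≤ x η δ ⟩
        approx x δ + (η + δ)           ≡⟨ cong (approx x δ +_) (+-comm η δ) ⟩
        approx x δ + (δ + η)           ≤⟨ +-monoʳ-≤ (approx x δ) (+-monoʳ-≤ δ (η≤3η η)) ⟩
        approx x δ + (δ + fromℕ 3 * η) ∎)
    where
    open ≤-Reasoning
    open +-*-Solver
  ... | inj₂ l≤x′ | inj₂ x≤h′ = approx x η , l≤x′ , x≤h′ , λ δ →
      (begin
        approx x δ                      ≤⟨ regular-≤ x δ η ⟩
        approx x η + (δ + η)            ≤⟨ +-monoʳ-≤ (approx x η) (+-monoʳ-≤ δ (η≤3η η)) ⟩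
        approx x η + (δ + fromℕ 3 * η)  ∎)
      , (begin
        approx x η                     ≤⟨ regular-≤ x η δ ⟩
        approx x δ + (η + δ)           ≡⟨ cong (approx x δ +_) (+-comm η δ) ⟩
        approx x δ + (δ + η)           ≤⟨ +-monoʳ-≤ (approx x δ) (+-monoʳ-≤ δ (η≤3η η)) ⟩
        approx x δ + (δ + fromℕ 3 * η) ∎)
    where
    open ≤-Reasoning

  -- All three comparisons are made at tolerance `η` and cost 2η each.
  Near-≤ : ∀ {x y p q η} .{{_ : Positive η}} → Near x p η → Near y q η → x ≤ℝ y → p ≤ q + fromℕ 6 * η
  Near-≤ {x} {y} {p} {q} {η} x≈p y≈q x≤y = begin
    p                                      ≤⟨ proj₂ (x≈p η) ⟩
    approx x η + (η + η)                   ≤⟨ +-monoˡ-≤ (η + η) (x≤y η) ⟩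
    approx y η + (η + η) + (η + η)         ≤⟨ +-monoˡ-≤ (η + η) (+-monoˡ-≤ (η + η) (proj₁ (y≈q η))) ⟩
    q + (η + η) + (η + η) + (η + η)        ≡⟨ solve 2 (λ q η → q :+ (η :+ η) :+ (η :+ η) :+ (η :+ η)
                                                 := q :+ con (fromℕ 6) :* η) refl q η ⟩
    q + fromℕ 6 * η                        ∎
    where
    open ≤-Reasoning
    open +-*-Solver

  -- The gap `r` is read off at the tolerance `ε` that witnesses the strict inequality. It is thus
  -- fixed before `η` is chosen and survives as `η` shrinks. The constant 6 agrees with `Near-≤`;
  -- the argument itself gives 2.
  Near-< : ∀ {x y} → x <ℝ y → ∃[ r ] 0ℚ < r ×
           (∀ {p q η} .{{_ : Positive η}} → Near x p η → Near y q η → p + r ≤ q + fromℕ 6 * η)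
  Near-< {x} {y} (ε , ε>0 , gap) = r , 0<r , bound
    where
    open ≤-Reasoning
    open +-*-Solver
    instance _ = ε>0
    a = approx x ε
    b = approx y ε
    r = b - (a + (ε + ε))
    0<r : 0ℚ < r
    0<r = subst (_< r) (+-inverseʳ (a + (ε + ε))) (+-monoˡ-< (- (a + (ε + ε))) gap)
    bound : ∀ {p q η} .{{_ : Positive η}} → Near x p η → Near y q η → p + r ≤ q + fromℕ 6 * η
    bound {p} {q} {η} x≈p y≈q = begin
      p + r                          ≤⟨ +-monoˡ-≤ r (proj₂ (x≈p ε)) ⟩
      a + (ε + η) + r                ≡⟨ solve 4 (λ a b ε η → a :+ (ε :+ η) :+ (b :- (a :+ (ε :+ ε)))
                                          := b :+ (η :- ε)) refl a b ε η ⟩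
      b + (η - ε)                    ≤⟨ +-monoˡ-≤ (η - ε) (proj₁ (y≈q ε)) ⟩
      q + (ε + η) + (η - ε)          ≡⟨ solve 3 (λ q ε η → q :+ (ε :+ η) :+ (η :- ε)
                                          := q :+ con (fromℕ 2) :* η) refl q ε η ⟩
      q + fromℕ 2 * η                ≤⟨ +-monoʳ-≤ q (*-monoʳ-≤-nonNeg η {{pos⇒nonNeg η}}
                                          (fromℕ-mono-≤ {2} {6} (ℕ.s≤s (ℕ.s≤s ℕ.z≤n)))) ⟩
      q + fromℕ 6 * η                ∎

  archimedean : ∀ C ρ .{{_ : NonNegative C}} .{{_ : Positive ρ}} → ∃[ η ] Positive η × C * η ≤ ρ
  archimedean C ρ = ρ * 1/D , η>0 , (begin
    C * (ρ * 1/D)          ≤⟨ *-monoʳ-≤-nonNeg (ρ * 1/D) {{pos⇒nonNeg (ρ * 1/D) {{η>0}}}} C≤D ⟩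
    D * (ρ * 1/D)          ≡⟨ solve 3 (λ D ρ i → D :* (ρ :* i) := ρ :* (D :* i)) refl D ρ 1/D ⟩
    ρ * (D * 1/D)          ≡⟨ cong (ρ *_) (*-inverseʳ D {{pos⇒nonZero D}}) ⟩
    ρ * 1ℚ                 ≡⟨ *-identityʳ ρ ⟩
    ρ                      ∎)
    where
    open ≤-Reasoning
    open +-*-Solver
    -- Adding 1 keeps the divisor positive when `C` is 0.
    D = C + 1ℚ
    instance
      D>0 : Positive D
      D>0 = nonNeg+pos⇒pos C 1ℚ
    1/D = (1/ D) {{pos⇒nonZero D}}
    η>0 : Positive (ρ * 1/D)
    η>0 = pos*pos⇒pos ρ 1/D {{1/pos⇒pos D}}
    C≤D : C ≤ D
    C≤D = ≤-trans (≤-reflexive (sym (+-identityʳ C))) (+-monoʳ-≤ C (nonNegative⁻¹ 1ℚ))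

  -- Rational linear functionals and their threshold maximisers

  sum-mono : ∀ {n} {f g : Vector ℚ n} → (∀ i → f i ≤ g i) → sum f ≤ sum g
  sum-mono {zero}  f≤g = ≤-refl
  sum-mono {suc n} f≤g = +-mono-≤ (f≤g zero) (sum-mono (λ i → f≤g (suc i)))

  sum-nonNeg : ∀ {n} {f : Vector ℚ n} → (∀ i → 0ℚ ≤ f i) → 0ℚ ≤ sum f
  sum-nonNeg {zero}  0≤f = ≤-refl
  sum-nonNeg {suc n} 0≤f = +-mono-≤ (0≤f zero) (sum-nonNeg (λ i → 0≤f (suc i)))

  term≤sum : ∀ {n} {f : Vector ℚ n} → (∀ i → 0ℚ ≤ f i) → ∀ i → f i ≤ sum f
  term≤sum {suc n} {f} 0≤f zero = ≤-trans (≤-reflexive (sym (+-identityʳ (f zero))))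
    (+-monoʳ-≤ (f zero) (sum-nonNeg (λ i → 0≤f (suc i))))
  term≤sum {suc n} {f} 0≤f (suc i) = ≤-trans (≤-reflexive (sym (+-identityˡ (f (suc i)))))
    (+-mono-≤ (0≤f zero) (term≤sum (λ i → 0≤f (suc i)) i))

  infix 8 _·ℚ_

  _·ℚ_ : ∀ {n} → Vector ℚ n → Vec Bool n → ℚ
  q ·ℚ x = sum (λ j → if lookup x j then q j else 0ℚ)

  Near-· : ∀ {n} (u : Vector ℝ n) (q : Vector ℚ n) η → 0ℚ ≤ η → (∀ j → Near (u j) (q j) η) →
           ∀ x → Near (u · x) (q ·ℚ x) (fromℕ n * η)
  Near-· {zero}  u q η 0≤η u≈q [] = Near-fromℚ 0ℚ (≤-reflexive (sym (*-zeroˡ η)))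
  Near-· {suc n} u q η 0≤η u≈q (b ∷ x) =
    subst (Near (u · (b ∷ x)) (q ·ℚ (b ∷ x))) (sym err)
      (Near-+ {if b then u zero else 0ℝ} {(λ j → u (suc j)) · x} (term b) (Near-· (λ j → u (suc j)) (λ j → q (suc j)) η 0≤η (λ j → u≈q (suc j)) x))
    where
    err : fromℕ (suc n) * η ≡ η + fromℕ n * η
    err = trans (cong (_* η) (fromℕ-+ 1 n))
      (trans (*-distribʳ-+ η 1ℚ (fromℕ n)) (cong (_+ fromℕ n * η) (*-identityˡ η)))
    term : ∀ b → Near (if b then u zero else 0ℝ) (if b then q zero else 0ℚ) η
    term true  = u≈q zero
    term false = Near-fromℚ 0ℚ 0≤η

  module _ {d n : ℕ} (q : Fin d → Vector ℚ n) (c : Vector ℚ d) where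

    value : Fin n → ℚ
    value j = sum (λ i → c i * q i j)

    sum-·ℚ : ∀ x → sum (λ i → c i * q i ·ℚ x) ≡ value ·ℚ x
    sum-·ℚ x = begin
      sum (λ i → c i * q i ·ℚ x)
        ≡⟨ sum-cong-≗ (λ i → *-distribˡ-sum (c i) (λ j → if lookup x j then q i j else 0ℚ)) ⟩
      sum (λ i → sum (λ j → c i * (if lookup x j then q i j else 0ℚ)))
        ≡⟨ ∑-comm (λ i j → c i * (if lookup x j then q i j else 0ℚ)) ⟩
      sum (λ j → sum (λ i → c i * (if lookup x j then q i j else 0ℚ)))
        ≡⟨ sum-cong-≗ (λ j → select j (lookup x j)) ⟩
      value ·ℚ x ∎
      where
      open ≡-Reasoning
      select : ∀ j b → sum (λ i → c i * (if b then q i j else 0ℚ)) ≡ (if b then value j else 0ℚ)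
      select j true  = refl
      select j false = trans (sum-cong-≗ (λ i → *-zeroʳ (c i))) (sum-replicate-zero d)

    -- Object `j` contributes `value j - t` to the functional if it is selected and 0 otherwise, so
    -- `x` makes the best choice for every object separately. The terms with a minus sign stand on
    -- the other side.
    threshold-maximal : ∀ t (x y : Vec Bool n) →
      (∀ j → lookup x j ≡ true → t ≤ value j) → (∀ j → lookup x j ≡ false → value j ≤ t) →
      value ·ℚ y + t * (λ _ → 1ℚ) ·ℚ x ≤ value ·ℚ x + t * (λ _ → 1ℚ) ·ℚ y
    threshold-maximal t x y in-above out-below = begin
      value ·ℚ y + t * (λ _ → 1ℚ) ·ℚ x
        ≡⟨ cong (value ·ℚ y +_) (*-distribˡ-sum t (λ j → pick x j 1ℚ)) ⟩
      value ·ℚ y + sum (λ j → t * pick x j 1ℚ)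
        ≡⟨ sym (∑-distrib-+ (λ j → pick y j (value j)) (λ j → t * pick x j 1ℚ)) ⟩
      sum (λ j → pick y j (value j) + t * pick x j 1ℚ)
        ≤⟨ sum-mono (λ j → exchange (lookup x j) (lookup y j) (in-above j) (out-below j)) ⟩
      sum (λ j → pick x j (value j) + t * pick y j 1ℚ)
        ≡⟨ ∑-distrib-+ (λ j → pick x j (value j)) (λ j → t * pick y j 1ℚ) ⟩
      value ·ℚ x + sum (λ j → t * pick y j 1ℚ)
        ≡⟨ cong (value ·ℚ x +_) (sym (*-distribˡ-sum t (λ j → pick y j 1ℚ))) ⟩
      value ·ℚ x + t * (λ _ → 1ℚ) ·ℚ y ∎
      where
      open ≤-Reasoning
      pick : Vec Bool n → Fin n → ℚ → ℚ
      pick x j p = if lookup x j then p else 0ℚ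
      exchange : ∀ a b {v} → (a ≡ true → t ≤ v) → (a ≡ false → v ≤ t) →
        (if b then v else 0ℚ) + t * (if a then 1ℚ else 0ℚ)
          ≤ (if a then v else 0ℚ) + t * (if b then 1ℚ else 0ℚ)
      exchange true  true  _   _   = ≤-refl
      exchange false false _   _   = ≤-refl
      exchange true  false {v} t≤v _ = begin
        0ℚ + t * 1ℚ ≡⟨ trans (+-identityˡ _) (*-identityʳ t) ⟩
        t           ≤⟨ t≤v refl ⟩
        v           ≡⟨ sym (trans (cong (v +_) (*-zeroʳ t)) (+-identityʳ v)) ⟩
        v + t * 0ℚ  ∎
      exchange false true  {v} _ v≤t = begin
        v + t * 0ℚ  ≡⟨ trans (cong (v +_) (*-zeroʳ t)) (+-identityʳ v) ⟩
        v           ≤⟨ v≤t refl ⟩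
        t           ≡⟨ sym (trans (+-identityˡ _) (*-identityʳ t)) ⟩
        0ℚ + t * 1ℚ ∎

  -- Pareto-optimality of one selection throughout a box

  module _ {d n : ℕ} (B : Box d n) (c : Vector ℚ d) (t : ℚ)
           (c>0 : ∀ i → Positive (c i)) (t>0 : Positive t) (x : Vec Bool n)
           (in-above : ∀ j → lookup x j ≡ true → t ≤ value (lo B) c j)
           (out-below : ∀ j → lookup x j ≡ false → value (hi B) c j ≤ t)
           (v : Fin d → Vector ℝ n) (v∈B : v ∈ᴮ B) where

    private
      instance _ = t>0

      c≥0 : ∀ i → NonNegative (c i)
      c≥0 i = pos⇒nonNeg (c i) {{c>0 i}}

      Λ = sum c + t

      instance
        Λ>0 : Positive Λ
        Λ>0 = nonNeg+pos⇒pos (sum c)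
          {{nonNegative (sum-nonNeg (λ i → <⇒≤ (positive⁻¹ (c i) {{c>0 i}})))}} t

      -- Replaces the real profits by rational ones inside the box, uniformly for all solutions `z`.
      -- Each of the `n` entries contributes an error of 3η, hence the choice of `η` below `ρ`
      -- divided by 3n.
      approximation : ∀ ρ .{{_ : Positive ρ}} → Σ[ q ∈ (Fin d → Vector ℚ n) ]
        (∀ i j → lo B i j ≤ q i j) × (∀ i j → q i j ≤ hi B i j) ×
        (∀ i z → Near (v i · z) (q i ·ℚ z) ρ)
      approximation ρ = q , (λ i j → proj₁ (proj₂ (near i j)))
                          , (λ i j → proj₁ (proj₂ (proj₂ (near i j))))
                          , λ i z → Near-weaken {v i · z} {q i ·ℚ z}
                              (≤-trans (≤-reflexive (sym (*-assoc (fromℕ n) (fromℕ 3) η))) (proj₂ (proj₂ small)))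
                              (Near-· (v i) (q i) (fromℕ 3 * η) 0≤3η
                                (λ j → proj₂ (proj₂ (proj₂ (near i j)))) z)
        where
        small : ∃[ η ] Positive η × fromℕ n * fromℕ 3 * η ≤ ρ
        small = archimedean (fromℕ n * fromℕ 3) ρ
          {{nonNeg*nonNeg⇒nonNeg (fromℕ n) {{fromℕ-nonNegative n}} (fromℕ 3)}}
        η = proj₁ small
        instance
          η>0 : Positive η
          η>0 = proj₁ (proj₂ small)
        near : ∀ i j → ∃[ q ] lo B i j ≤ q × q ≤ hi B i j × Near (v i j) q (fromℕ 3 * η)
        near i j = Near-interval {v i j} η (lo≤hi B i j) (proj₁ (v∈B i j)) (proj₂ (v∈B i j))
        q : Fin d → Vector ℚ n
        q i j = proj₁ (near i j)
        0≤3η : 0ℚ ≤ fromℕ 3 * η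
        0≤3η = nonNegative⁻¹ (fromℕ 3 * η) {{pos⇒nonNeg (fromℕ 3 * η) {{pos*pos⇒pos (fromℕ 3) η}}}}

      value-mono : ∀ {p q : Fin d → Vector ℚ n} → (∀ i j → p i j ≤ q i j) →
                   ∀ j → value p c j ≤ value q c j
      value-mono p≤q j = sum-mono (λ i → *-monoˡ-≤-nonNeg (c i) {{c≥0 i}} (p≤q i j))

      -- Here `γ i` and `ω` are the amounts by which `y` beats `x` in profit `i` and in weight, up
      -- to `ρ`. Weighted by `c` and `t`, they add up to a gain in the functional that `x`
      -- maximises, so only the weighted tolerances can remain.
      total-gain : ∀ ρ (q : Fin d → Vector ℚ n) (y : Vec Bool n) (γ : Vector ℚ d) ω →
        (∀ i j → lo B i j ≤ q i j) → (∀ i j → q i j ≤ hi B i j) →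
        (∀ i → q i ·ℚ x + γ i ≤ q i ·ℚ y + ρ) →
        (λ _ → 1ℚ) ·ℚ y + ω ≤ (λ _ → 1ℚ) ·ℚ x + ρ →
        sum (λ i → c i * γ i) + t * ω ≤ Λ * ρ
      total-gain ρ q y γ ω lo≤q q≤hi gain gainʷ = begin
        Γ + t * ω
          ≡⟨ solve 5 (λ Γ tω Q tw tw′ → Γ :+ tω := ((Q :+ Γ) :+ (tw :+ tω)) :- (Q :+ tw))
               refl Γ (t * ω) (q· x) (t * w y) (t * w x) ⟩
        ((q· x + Γ) + (t * w y + t * ω)) - (q· x + t * w y)
          ≤⟨ +-mono-≤ (+-mono-≤ weighted weightedʷ) (neg-antimono-≤ maximal) ⟩
        ((q· y + sum c * ρ) + (t * w x + t * ρ)) - (q· y + t * w x)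
          ≡⟨ solve 5 (λ Q s t tw ρ → ((Q :+ s :* ρ) :+ (tw :+ t :* ρ)) :- (Q :+ tw) := (s :+ t) :* ρ)
               refl (q· y) (sum c) t (t * w x) ρ ⟩
        Λ * ρ ∎
        where
        open ≤-Reasoning
        open +-*-Solver
        Γ = sum (λ i → c i * γ i)
        w : Vec Bool n → ℚ
        w z = (λ _ → 1ℚ) ·ℚ z
        q· : Vec Bool n → ℚ
        q· z = sum (λ i → c i * q i ·ℚ z)
        weighted : q· x + Γ ≤ q· y + sum c * ρ
        weighted = begin
          q· x + Γ
            ≡⟨ sym (∑-distrib-+ (λ i → c i * q i ·ℚ x) (λ i → c i * γ i)) ⟩
          sum (λ i → c i * q i ·ℚ x + c i * γ i)
            ≡⟨ sum-cong-≗ (λ i → sym (*-distribˡ-+ (c i) (q i ·ℚ x) (γ i))) ⟩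
          sum (λ i → c i * (q i ·ℚ x + γ i))
            ≤⟨ sum-mono (λ i → *-monoˡ-≤-nonNeg (c i) {{c≥0 i}} (gain i)) ⟩
          sum (λ i → c i * (q i ·ℚ y + ρ))
            ≡⟨ sum-cong-≗ (λ i → trans (*-distribˡ-+ (c i) (q i ·ℚ y) ρ)
                 (cong (c i * q i ·ℚ y +_) (*-comm (c i) ρ))) ⟩
          sum (λ i → c i * q i ·ℚ y + ρ * c i)
            ≡⟨ ∑-distrib-+ (λ i → c i * q i ·ℚ y) (λ i → ρ * c i) ⟩
          q· y + sum (λ i → ρ * c i)
            ≡⟨ cong (q· y +_) (trans (sym (*-distribˡ-sum ρ c)) (*-comm ρ (sum c))) ⟩
          q· y + sum c * ρ ∎
        weightedʷ : t * w y + t * ω ≤ t * w x + t * ρ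
        weightedʷ = begin
          t * w y + t * ω   ≡⟨ sym (*-distribˡ-+ t (w y) ω) ⟩
          t * (w y + ω)     ≤⟨ *-monoˡ-≤-nonNeg t {{pos⇒nonNeg t}} gainʷ ⟩
          t * (w x + ρ)     ≡⟨ *-distribˡ-+ t (w x) ρ ⟩
          t * w x + t * ρ   ∎
        maximal : q· y + t * w x ≤ q· x + t * w y
        maximal = subst₂ (λ a b → a + t * w x ≤ b + t * w y)
          (sym (sum-·ℚ q c y)) (sym (sum-·ℚ q c x))
          (threshold-maximal q c t x y
            -- The weights `c` are positive, so values grow with the profits: the conditions at the
            -- two corners of the box pass to every `q` between them.
            (λ j xj → ≤-trans (in-above j xj) (value-mono lo≤q j))
            (λ j xj → ≤-trans (value-mono q≤hi j) (out-below j xj)))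

      0≤c*γ : ∀ {γ : Vector ℚ d} → (∀ i → 0ℚ ≤ γ i) → ∀ i → 0ℚ ≤ c i * γ i
      0≤c*γ {γ} 0≤γ i = ≤-trans (≤-reflexive (sym (*-zeroʳ (c i))))
        (*-monoˡ-≤-nonNeg (c i) {{c≥0 i}} (0≤γ i))

      -- A fixed gain μ > 0 contradicts total-gain once the tolerance is small.
      no-gain : ∀ {y} (γ : Vector ℚ d) ω → 0ℚ < sum (λ i → c i * γ i) + t * ω →
        (∀ ρ .{{_ : Positive ρ}} i {p q} → Near (v i · x) p ρ → Near (v i · y) q ρ →
           p + γ i ≤ q + fromℕ 6 * ρ) →
        (∀ ρ .{{_ : Positive ρ}} {p q} → Near ((λ _ → 1ℝ) · y) p ρ → Near ((λ _ → 1ℝ) · x) q ρ →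
           p + ω ≤ q + fromℕ 6 * ρ) → ⊥
      no-gain {y} γ ω 0<μ gain gainʷ = <-irrefl refl (begin-strict
        μ                    ≤⟨ total-gain (fromℕ 6 * ρ) (proj₁ near) y γ ω
                                  (proj₁ (proj₂ near)) (proj₁ (proj₂ (proj₂ near)))
                                  (λ i → gain ρ i (nearᵛ i x) (nearᵛ i y)) (gainʷ ρ (nearʷ y) (nearʷ x)) ⟩
        Λ * (fromℕ 6 * ρ)    ≡⟨ sym (*-assoc Λ (fromℕ 6) ρ) ⟩
        Λ * fromℕ 6 * ρ      ≤⟨ proj₂ (proj₂ small) ⟩
        ½ * μ                ≡⟨ sym (+-identityʳ (½ * μ)) ⟩
        ½ * μ + 0ℚ           <⟨ +-monoʳ-< (½ * μ) (positive⁻¹ (½ * μ) {{½μ>0}}) ⟩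
        ½ * μ + ½ * μ        ≡⟨ solve 1 (λ μ → con ½ :* μ :+ con ½ :* μ := μ) refl μ ⟩
        μ                    ∎)
        where
        open ≤-Reasoning
        open +-*-Solver
        μ = sum (λ i → c i * γ i) + t * ω
        ½μ>0 : Positive (½ * μ)
        ½μ>0 = pos*pos⇒pos ½ μ {{positive 0<μ}}
        small : ∃[ ρ ] Positive ρ × Λ * fromℕ 6 * ρ ≤ ½ * μ
        small = archimedean (Λ * fromℕ 6) (½ * μ)
          {{pos⇒nonNeg (Λ * fromℕ 6) {{pos*pos⇒pos Λ (fromℕ 6)}}}} {{½μ>0}}
        ρ = proj₁ small
        instance
          ρ>0 : Positive ρ
          ρ>0 = proj₁ (proj₂ small)
        near = approximation ρ
        nearᵛ = proj₂ (proj₂ (proj₂ near))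
        0≤ρ = <⇒≤ (positive⁻¹ ρ)
        nearʷ : ∀ z → Near ((λ _ → 1ℝ) · z) ((λ _ → 1ℚ) ·ℚ z) ρ
        nearʷ z = Near-weaken {(λ _ → 1ℝ) · z} {(λ _ → 1ℚ) ·ℚ z}
          (≤-trans (≤-reflexive (*-zeroʳ (fromℕ n))) 0≤ρ)
          (Near-· (λ _ → 1ℝ) (λ _ → 1ℚ) 0ℚ ≤-refl (λ _ → Near-fromℚ 1ℚ ≤-refl) z)

      +0≤ : ∀ {p q} → p ≤ q → p + 0ℚ ≤ q
      +0≤ {p} p≤q = ≤-trans (≤-reflexive (+-identityʳ p)) p≤q

    -- The strict inequality in a domination has a rational gap `r`. It enters the weighted gain
    -- with the factor `t` if it concerns the weight and with `c k` if it concerns profit `k`. Both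
    -- factors are positive, so `no-gain` applies.
    threshold-undominated : ∀ y → ¬ Dominates (unitWeightKnapsack v) y x
    threshold-undominated y (w≤ , v≤ , inj₁ w<) = no-gain {y} (λ _ → 0ℚ) r
        (subst (_< sum (λ i → c i * 0ℚ) + t * r) (+-identityˡ 0ℚ)
          (+-mono-≤-< (sum-nonNeg (0≤c*γ (λ _ → ≤-refl)))
            (positive⁻¹ (t * r) {{pos*pos⇒pos t r {{positive (proj₁ (proj₂ gap))}}}})))
        (λ ρ i p q → +0≤ (Near-≤ {v i · x} {v i · y} p q (v≤ i)))
        (λ ρ p q → proj₂ (proj₂ gap) p q)
      where
      gap = Near-< {(λ _ → 1ℝ) · y} {(λ _ → 1ℝ) · x} w<
      r = proj₁ gap
    threshold-undominated y (w≤ , v≤ , inj₂ (k , v<)) = no-gain {y} γ 0ℚ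
        (subst (_< Γ + t * 0ℚ) (+-identityʳ 0ℚ)
          (+-mono-<-≤ (<-≤-trans (subst (λ γₖ → 0ℚ < c k * γₖ) (sym γk≡r)
              (positive⁻¹ (c k * r) {{pos*pos⇒pos (c k) {{c>0 k}} r {{positive 0<r}}}}))
              (term≤sum (0≤c*γ {γ} 0≤γ) k))
            (≤-reflexive (sym (*-zeroʳ t)))))
        gain
        (λ ρ p q → +0≤ (Near-≤ {(λ _ → 1ℝ) · y} {(λ _ → 1ℝ) · x} p q w≤))
      where
      gap = Near-< {v k · x} {v k · y} v<
      r = proj₁ gap
      0<r : 0ℚ < r
      0<r = proj₁ (proj₂ gap)
      γ : Vector ℚ d
      γ i with i ≟ k
      ... | yes _ = r
      ... | no _  = 0ℚ
      Γ = sum (λ i → c i * γ i)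
      γk≡r : γ k ≡ r
      γk≡r with k ≟ k
      ... | yes _  = refl
      ... | no k≢k = contradiction refl k≢k
      0≤γ : ∀ i → 0ℚ ≤ γ i
      0≤γ i with i ≟ k
      ... | yes _ = <⇒≤ 0<r
      ... | no _  = ≤-refl
      gain : ∀ ρ .{{_ : Positive ρ}} i {p q} → Near (v i · x) p ρ → Near (v i · y) q ρ →
             p + γ i ≤ q + fromℕ 6 * ρ
      gain ρ i p q with i ≟ k
      ... | yes refl = proj₂ (proj₂ gap) p q
      ... | no _     = +0≤ (Near-≤ {v i · x} {v i · y} p q (v≤ i))

    threshold-paretoOptimal : ParetoOptimal (unitWeightKnapsack v) x
    threshold-paretoOptimal = tt , λ y _ → threshold-undominated y

-- Threshold sets on the integer grid: auxiliary sums and windows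

module Thresholds where
  open import Data.Bool using (Bool; true; false; if_then_else_)
  open import Data.Fin as Fin using (Fin; zero; suc; toℕ)
  open import Data.Fin.Properties using (toℕ<n; toℕ-injective; all?)
  open import Data.List using (List; []; _∷_; tabulate; allFin; cartesianProductWith; length)
  open import Data.List.Properties using (length-tabulate)
  import Data.List.Relation.Unary.All as ListAll
  open import Data.List.Membership.Propositional.Properties using (∈-allFin)
  open import Data.Nat
  open import Data.Nat.DivMod using (m/n*n≤m; m≡m%n+[m/n]*n; m%n<n)
  open import Data.Nat.Properties
  open import Data.Nat.Solver using (module +-*-Solver)
  open import Data.Product using (_×_; _,_; proj₁; proj₂; ∃-syntax)
  open import Data.Sum using (_⊎_; inj₁; inj₂)
  open import Data.Vec using (Vec; []; _∷_; lookup; map)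
  open import Data.Vec.Functional using (Vector; foldr)
  open import Data.Vec.Properties using (∷-injective)
  open import Data.Vec.Relation.Unary.Any using (Any; here; there)
  open import Relation.Binary.PropositionalEquality
  open import Relation.Nullary using (¬_; Dec; yes; no; does; contradiction)
  open import Relation.Nullary.Decidable using (_×-dec_; _⊎-dec_; dec-true)
  open import Relation.Unary using (Decidable)
  open import Function using (_∘_; id)
  open Counting

  sumᶠ : ∀ {n} → Vector ℕ n → ℕ
  sumᶠ = foldr _+_ 0

  sumᶠ-mono : ∀ {n} {f g : Vector ℕ n} → (∀ i → f i ≤ g i) → sumᶠ f ≤ sumᶠ g
  sumᶠ-mono {zero}  f≤g = z≤n
  sumᶠ-mono {suc n} f≤g = +-mono-≤ (f≤g zero) (sumᶠ-mono (f≤g ∘ suc))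

  sumᶠ-cong : ∀ {n} {f g : Vector ℕ n} → (∀ i → f i ≡ g i) → sumᶠ f ≡ sumᶠ g
  sumᶠ-cong {zero}  f≡g = refl
  sumᶠ-cong {suc n} f≡g = cong₂ _+_ (f≡g zero) (sumᶠ-cong (f≡g ∘ suc))

  sumᶠ-+ : ∀ {n} (f g : Vector ℕ n) → sumᶠ (λ i → f i + g i) ≡ sumᶠ f + sumᶠ g
  sumᶠ-+ {zero}  f g = refl
  sumᶠ-+ {suc n} f g rewrite sumᶠ-+ (f ∘ suc) (g ∘ suc) =
    solve 4 (λ a b c d → (a :+ b) :+ (c :+ d) := (a :+ c) :+ (b :+ d)) refl
      (f zero) (g zero) (sumᶠ (f ∘ suc)) (sumᶠ (g ∘ suc))
    where open +-*-Solver

  sumᶠ-const : ∀ n c → sumᶠ {n} (λ _ → c) ≡ n * c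
  sumᶠ-const zero    c = refl
  sumᶠ-const (suc n) c = cong (c +_) (sumᶠ-const n c)

  sumᶠ-*ˡ : ∀ {n} c (f : Vector ℕ n) → sumᶠ (λ i → c * f i) ≡ c * sumᶠ f
  sumᶠ-*ˡ {zero}  c f = sym (*-zeroʳ c)
  sumᶠ-*ˡ {suc n} c f rewrite sumᶠ-*ˡ c (f ∘ suc) = sym (*-distribˡ-+ c (f zero) _)

  argmax : ∀ {n} (f : Vector ℕ (suc n)) → ∃[ i ] ∀ j → f j ≤ f i
  argmax {zero}  f = zero , λ { zero → ≤-refl }
  argmax {suc n} f with argmax (f ∘ suc)
  ... | i , max with ≤-total (f zero) (f (suc i))
  ...   | inj₁ f0≤fi = suc i , λ { zero → f0≤fi ; (suc j) → max j }
  ...   | inj₂ fi≤f0 = zero  , λ { zero → ≤-refl ; (suc j) → ≤-trans (max j) fi≤f0 }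

  -- Meant for columns of cells: the score increases along a column, so it stays in a given interval
  -- only for a window of consecutive indices.
  ∑-tabulate-≤ : ∀ {M k} {A : Set} (h : Fin M → A) (f : A → ℕ) o →
    (∀ i → f (h i) ≤ 1) → (∀ i → toℕ i < o → f (h i) ≡ 0) → (∀ i → o + k ≤ toℕ i → f (h i) ≡ 0) →
    ∑ (tabulate h) f ≤ k
  ∑-tabulate-≤ {zero}  h f o f≤1 below above = z≤n
  ∑-tabulate-≤ {suc M} h f (suc o) f≤1 below above rewrite below zero z<s =
    ∑-tabulate-≤ (h ∘ suc) f o (f≤1 ∘ suc) (λ i i<o → below (suc i) (s<s i<o))
      (λ i i≥ → above (suc i) (s≤s i≥))
  ∑-tabulate-≤ {suc M} {zero} h f zero f≤1 below above rewrite above zero z≤n =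
    ∑-tabulate-≤ (h ∘ suc) f zero (f≤1 ∘ suc) (λ _ ()) (λ i _ → above (suc i) z≤n)
  ∑-tabulate-≤ {suc M} {suc k} h f zero f≤1 below above =
    +-mono-≤ (f≤1 zero) (∑-tabulate-≤ (h ∘ suc) f zero (f≤1 ∘ suc) (λ _ ())
      (λ i i≥ → above (suc i) (s≤s i≥)))

  ∑-tabulate-≥ : ∀ {M k} {A : Set} (h : Fin M → A) (f : A → ℕ) o → o + k ≤ M →
    (∀ i → o ≤ toℕ i → toℕ i < o + k → 1 ≤ f (h i)) → k ≤ ∑ (tabulate h) f
  ∑-tabulate-≥ {zero}  h f zero    k≤0 f≥1 = k≤0
  ∑-tabulate-≥ {suc M} {zero}  h f zero p f≥1 = z≤n
  ∑-tabulate-≥ {suc M} {suc k} h f zero (s≤s p) f≥1 =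
    +-mono-≤ (f≥1 zero z≤n z<s) (∑-tabulate-≥ (h ∘ suc) f zero p (λ i _ i< → f≥1 (suc i) z≤n (s<s i<)))
  ∑-tabulate-≥ {suc M} h f (suc o) (s≤s p) f≥1 =
    ≤-trans (∑-tabulate-≥ (h ∘ suc) f o p (λ i i≥ i< → f≥1 (suc i) (s≤s i≥) (s<s i<))) (m≤n+m _ _)

  sum-indicator : ∀ {e} (i : Fin e) k → sumᶠ (λ j → if does (i Fin.≟ j) then k else 0) ≡ k
  sum-indicator {suc e} zero k = trans (cong (k +_) (trans (sumᶠ-const e 0) (*-zeroʳ e))) (+-identityʳ k)
  sum-indicator (suc i) k = sum-indicator i k

  any-map-≡ : ∀ {A B : Set} {P : A → Set} {f g : A → B} {m} {w : Vec A m} →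
              Any P w → map f w ≡ map g w → ∃[ x ] P x × f x ≡ g x
  any-map-≡ {w = x ∷ _} (here px) fw≡gw = x , px , proj₁ (∷-injective fw≡gw)
  any-map-≡ {w = _ ∷ _} (there p) fw≡gw = any-map-≡ p (proj₂ (∷-injective fw≡gw))

  lookup-injective : ∀ {A : Set} {m} {v w : Vec A m} → (∀ j → lookup v j ≡ lookup w j) → v ≡ w
  lookup-injective {v = []}    {[]}    _ = refl
  lookup-injective {v = _ ∷ _} {_ ∷ _} p = cong₂ _∷_ (p zero) (lookup-injective (p ∘ suc))

  module _ {M : ℕ} where

    InBox : ∀ {e} → Vector ℕ e → ℕ → Vec (Fin M) e → Set
    InBox o w r = ∀ j → o j ≤ toℕ (lookup r j) × toℕ (lookup r j) < o j + w

    inBox? : ∀ {e} (o : Vector ℕ e) w → Decidable (InBox o w)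
    inBox? o w r = all? (λ j → o j ≤? toℕ (lookup r j) ×-dec toℕ (lookup r j) <? o j + w)

    count-inBox : ∀ {e} (o : Vector ℕ e) w → (∀ j → o j + w ≤ M) →
                  w ^ e ≤ count (inBox? o w) (words e (allFin M))
    count-inBox {zero}  o w o+w≤M =
      ≤-reflexive (sym (trans (+-identityʳ _) (𝟙-yes (inBox? o w []) (λ ()))))
    count-inBox {suc e} o w o+w≤M = begin
      w * w ^ e
        ≤⟨ *-mono-≤ (∑-tabulate-≥ id (λ y → 𝟙 (head? y)) (o zero) (o+w≤M zero)
                      (λ y lb ub → ≤-reflexive (sym (𝟙-yes (head? y) (lb , ub)))))
                    (count-inBox (o ∘ suc) w (o+w≤M ∘ suc)) ⟩
      ∑ (allFin M) (λ y → 𝟙 (head? y)) * ∑ rs (λ r → 𝟙 (tail? r))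
        ≡⟨ sym (∑-*ʳ (allFin M) (λ y → 𝟙 (head? y)) _) ⟩
      ∑ (allFin M) (λ y → 𝟙 (head? y) * ∑ rs (λ r → 𝟙 (tail? r)))
        ≡⟨ ∑-cong (allFin M) (λ y → sym (∑-*ˡ rs (𝟙 (head? y)) (λ r → 𝟙 (tail? r)))) ⟩
      ∑ (allFin M) (λ y → ∑ rs (λ r → 𝟙 (head? y) * 𝟙 (tail? r)))
        ≤⟨ ∑-mono (allFin M) (λ y → ∑-mono rs (λ r →
             𝟙-× (head? y) (tail? r) (inBox? o w (y ∷ r)) (λ { p q zero → p ; p q (suc j) → q j }))) ⟩
      ∑ (allFin M) (λ y → ∑ rs (λ r → 𝟙 (inBox? o w (y ∷ r))))
        ≡⟨ sym (∑-product _∷_ (allFin M) rs _) ⟩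
      count (inBox? o w) (words (suc e) (allFin M)) ∎
      where
      open ≤-Reasoning
      rs = words e (allFin M)
      head? = λ (y : Fin M) → o zero ≤? toℕ y ×-dec toℕ y <? o zero + w
      tail? = inBox? (o ∘ suc) w

  -- The grid, the parameters and the kinds of cells

  -- Both constants depend on the dimension only. The good cells of each kind make up at least 1 /
  -- (n R) of all cells, and, once `n` is at least 2e, each parameter is regular on at least 1 / K
  -- of the grid.
  R K : ℕ → ℕ
  R e = 8 * (4 * suc e) ^ e
  K e = 2 * (2 ^ e * e ! * R e ^ e)

  K≢0 : ∀ e → NonZero (K e)
  K≢0 e = m*n≢0 2 (2 ^ e * e ! * R e ^ e) {{_}} {{m*n≢0 (2 ^ e * e !) (R e ^ e)
    {{m*n≢0 (2 ^ e) (e !) {{m^n≢0 2 e}} {{e !≢0}}}}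
    {{m^n≢0 (R e) e {{m*n≢0 8 ((4 * suc e) ^ e) {{_}} {{m^n≢0 (4 * suc e) e}}}}}}}}

  module _ (n e : ℕ) .{{n≢0 : NonZero n}} where

    -- M cells per coordinate.  In units of 1/M the score is Q y + Σ (n + aⱼ) rⱼ;
    -- Θ bounds its variation within a cell and also is the width of the slab
    -- above the threshold τ in which good cells lie.
    d Q M Θ τ : ℕ
    d = suc e
    Q = 2 * n
    M = 4 * d * Q
    Θ = d * Q
    τ = 3 * d * Q * Q

    instance
      Q≢0 : NonZero Q
      Q≢0 = m*n≢0 2 n

    Cell Param : Set
    Cell  = Vec (Fin M) d
    Param = Vec (Fin n) e

    -- Divided by `Q`, the first coefficient is 1 and each of the others runs through `n` values in
    -- [1/2, 1) at distance 1 / (2n).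
    tilt : Param → Vector ℕ e
    tilt a j = n + toℕ (lookup a j)

    coefficient : Param → Vector ℕ d
    coefficient a zero    = Q
    coefficient a (suc j) = tilt a j

    rest : Param → Vec (Fin M) e → ℕ
    rest a r = sumᶠ (λ j → tilt a j * toℕ (lookup r j))

    score : Param → Cell → ℕ
    score a x = sumᶠ (λ i → coefficient a i * toℕ (lookup x i))

    tilt≤Q : ∀ a j → tilt a j ≤ Q
    tilt≤Q a j = +-monoʳ-≤ n (≤-trans (<⇒≤ (toℕ<n (lookup a j))) (≤-reflexive (sym (+-identityʳ n))))

    sum-coefficient≤Θ : ∀ a → sumᶠ (coefficient a) ≤ Θ
    sum-coefficient≤Θ a = +-monoʳ-≤ Q (≤-trans (sumᶠ-mono (tilt≤Q a)) (≤-reflexive (sumᶠ-const e Q)))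

    -- The score is taken at the lower corner, so score + Θ bounds it from above
    -- on the cell: the threshold does not cut through the interior of a certain
    -- cell.
    Certain Far : Param → Cell → Set
    Certain a x = score a x + Θ < τ ⊎ τ ≤ score a x
    Far     a x = score a x + Θ < τ ⊎ τ + Θ < score a x

    -- The i-th cluster is the cube of side Q with lower corner offset i.
    offset : Fin e → Vector ℕ e
    offset i j = if does (i Fin.≟ j) then 2 * d * Q else 0

    Good : Param → Fin e → Cell → Set
    Good a i (y ∷ r) = (τ ≤ score a (y ∷ r) × score a (y ∷ r) ≤ τ + Θ) × InBox (offset i) Q r

    certain? : ∀ a → Decidable (Certain a)
    certain? a x = score a x + Θ <? τ ⊎-dec τ ≤? score a x

    far? : ∀ a → Decidable (Far a)
    far? a x = score a x + Θ <? τ ⊎-dec τ + Θ <? score a x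

    good? : ∀ a i → Decidable (Good a i)
    good? a i (y ∷ r) = (τ ≤? score a (y ∷ r) ×-dec score a (y ∷ r) ≤? τ + Θ) ×-dec inBox? (offset i) Q r

    far⇒certain : ∀ a {x} → Far a x → Certain a x
    far⇒certain a (inj₁ below) = inj₁ below
    far⇒certain a (inj₂ above) = inj₂ (≤-trans (m≤m+n τ Θ) (<⇒≤ above))

    good⇒certain : ∀ a i {x} → Good a i x → Certain a x
    good⇒certain a i {_ ∷ _} ((τ≤s , _) , _) = inj₂ τ≤s

    good⇒¬far : ∀ a i {x} → Good a i x → ¬ Far a x
    good⇒¬far a i {_ ∷ _} ((τ≤s , _) , _) (inj₁ s+Θ<τ) = <⇒≱ s+Θ<τ (≤-trans τ≤s (m≤m+n _ Θ))
    good⇒¬far a i {_ ∷ _} ((_ , s≤τ+Θ) , _) (inj₂ τ+Θ<s) = <⇒≱ τ+Θ<s s≤τ+Θ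

    -- The first coordinate runs in the inner list, so that sums over cells become sums over
    -- columns. Along a column the score rises in steps of exactly `Q`.
    cells : List Cell
    cells = cartesianProductWith (λ r y → y ∷ r) (words e (allFin M)) (allFin M)

    length-cells : length cells ≡ M ^ e * M
    length-cells = trans (length-product (λ r y → y ∷ r) (words e (allFin M)) (allFin M))
      (cong₂ _*_ (trans (length-words e (allFin M)) (cong (_^ e) (length-tabulate {n = M} id)))
                 (length-tabulate {n = M} id))

    ∑-cells : ∀ f → ∑ cells f ≡ ∑ (words e (allFin M)) (λ r → ∑ (allFin M) (λ y → f (y ∷ r)))
    ∑-cells = ∑-product (λ r y → y ∷ r) (words e (allFin M)) (allFin M)

    -- Few cells lie near the threshold

    -- The indicator of the cells that are not far, as a function of the score alone. Their number
    -- plays the part of `σ` in Bernoulli's inequality.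
    near : ℕ → ℕ
    near s = 1 ∸ 𝟙 (s + Θ <? τ ⊎-dec τ + Θ <? s)

    #near : Param → ℕ
    #near a = ∑ cells (λ x → near (score a x))

    far+near : ∀ a → count (far? a) cells + #near a ≡ length cells
    far+near a = begin
      count (far? a) cells + #near a
        ≡⟨ sym (∑-distrib-+ cells (λ x → 𝟙 (far? a x)) (λ x → near (score a x))) ⟩
      ∑ cells (λ x → 𝟙 (far? a x) + near (score a x))
        ≡⟨ ∑-cong cells (λ x → m+[n∸m]≡n (𝟙≤1 (far? a x))) ⟩
      ∑ cells (λ _ → 1)
        ≡⟨ trans (∑-const cells 1) (*-identityʳ _) ⟩
      length cells ∎
      where open ≡-Reasoning

    near≡0 : ∀ {s} → s + Θ < τ ⊎ τ + Θ < s → near s ≡ 0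
    near≡0 far = cong (1 ∸_) (𝟙-yes (_ <? τ ⊎-dec τ + Θ <? _) far)

    <⇒1+[m/n]*n≤ : ∀ m y → y < m / Q → Q + Q * y ≤ m
    <⇒1+[m/n]*n≤ m y y<m/Q = begin
      Q + Q * y      ≡⟨ cong (Q +_) (*-comm Q y) ⟩
      suc y * Q      ≤⟨ *-monoˡ-≤ Q y<m/Q ⟩
      m / Q * Q      ≤⟨ m/n*n≤m m Q ⟩
      m              ∎
      where open ≤-Reasoning

    m<Q+Q*[m/Q] : ∀ m → m < Q + Q * (m / Q)
    m<Q+Q*[m/Q] m = begin-strict
      m                    ≡⟨ m≡m%n+[m/n]*n m Q ⟩
      m % Q + m / Q * Q    <⟨ +-monoˡ-< (m / Q * Q) (m%n<n m Q) ⟩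
      Q + m / Q * Q        ≡⟨ cong (Q +_) (*-comm (m / Q) Q) ⟩
      Q + Q * (m / Q)      ∎
      where open ≤-Reasoning

    -- The near scores fill an interval of length `2 * Θ`, that is, 2d steps of the column, which
    -- can contain 2d + 1 points.
    near-column : ∀ a r → ∑ (allFin M) (λ y → near (score a (y ∷ r))) ≤ 2 * d + 1
    near-column a r = ∑-tabulate-≤ {M} id (λ y → near (Q * toℕ y + c)) o
      (λ y → m∸n≤m 1 (𝟙 (Q * toℕ y + c + Θ <? τ ⊎-dec τ + Θ <? Q * toℕ y + c)))
      (λ y y<o → near≡0 {Q * toℕ y + c} (inj₁ (below (toℕ y) y<o)))
      (λ y y≥ → near≡0 {Q * toℕ y + c} (inj₂ (above (toℕ y) y≥)))
      where
      open ≤-Reasoning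
      open +-*-Solver
      c = rest a r
      -- If `c + Θ` exceeds `τ`, the truncated difference and `o` are 0, and there is no index below
      -- the window.
      z = τ ∸ (c + Θ)
      o = z / Q
      below : ∀ y → y < o → Q * y + c + Θ < τ
      below y y<o = begin-strict
        Q * y + c + Θ          ≡⟨ +-assoc (Q * y) c Θ ⟩
        Q * y + (c + Θ)        <⟨ +-monoˡ-< (c + Θ) (m<n+m (Q * y) (>-nonZero⁻¹ Q)) ⟩
        Q + Q * y + (c + Θ)    ≤⟨ +-monoˡ-≤ (c + Θ) Q+Qy≤z ⟩
        z + (c + Θ)            ≡⟨ m∸n+n≡m {τ} {c + Θ} (<⇒≤ (m∸n≢0⇒n<m {τ} {c + Θ} z≢0)) ⟩
        τ                      ∎
        where
        Q+Qy≤z = <⇒1+[m/n]*n≤ z y y<o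
        z≢0 : z ≢ 0
        z≢0 z≡0 = contradiction (n≤0⇒n≡0 (subst (Q ≤_) z≡0 (≤-trans (m≤m+n Q _) Q+Qy≤z))) (≢-nonZero⁻¹ Q)
      above : ∀ y → o + (2 * d + 1) ≤ y → τ + Θ < Q * y + c
      above y o+k≤y = +-cancelʳ-< Θ _ _ (begin-strict
        τ + Θ + Θ                            ≤⟨ +-monoˡ-≤ Θ (+-monoˡ-≤ Θ (m≤n+m∸n τ (c + Θ))) ⟩
        c + Θ + z + Θ + Θ                    <⟨ +-monoˡ-< Θ (+-monoˡ-< Θ (+-monoʳ-< (c + Θ) (m<Q+Q*[m/Q] z))) ⟩
        c + Θ + (Q + Q * o) + Θ + Θ          ≡⟨ solve 4 (λ c d Q o → c :+ d :* Q :+ (Q :+ Q :* o) :+ d :* Q :+ d :* Q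
                                                  := Q :* (o :+ (con 2 :* d :+ con 1)) :+ c :+ d :* Q) refl c d Q o ⟩
        Q * (o + (2 * d + 1)) + c + Θ        ≤⟨ +-monoˡ-≤ Θ (+-monoˡ-≤ c (*-monoʳ-≤ Q o+k≤y)) ⟩
        Q * y + c + Θ                        ∎)

    -- At most 2d + 1 ≤ 4d of the M = 8dn cells of a column are near: a share of 1 / (2n), as
    -- Bernoulli's inequality requires.
    #near-small : ∀ a → 2 * (n * #near a) ≤ length cells
    #near-small a = begin
      2 * (n * #near a)
        ≡⟨ cong (λ s → 2 * (n * s)) (∑-cells (λ x → near (score a x))) ⟩
      2 * (n * ∑ rs (λ r → ∑ (allFin M) (λ y → near (score a (y ∷ r)))))
        ≤⟨ *-monoʳ-≤ 2 (*-monoʳ-≤ n (∑-mono rs (near-column a))) ⟩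
      2 * (n * ∑ rs (λ _ → 2 * d + 1))
        ≡⟨ cong (λ s → 2 * (n * s)) (∑-const rs (2 * d + 1)) ⟩
      2 * (n * (length rs * (2 * d + 1)))
        ≤⟨ *-monoʳ-≤ 2 (*-monoʳ-≤ n (*-monoʳ-≤ (length rs) 2d+1≤4d)) ⟩
      2 * (n * (length rs * (4 * d)))
        ≡⟨ solve 3 (λ n l d → con 2 :* (n :* (l :* (con 4 :* d))) := l :* (con 4 :* d :* (con 2 :* n)))
             refl n (length rs) d ⟩
      length rs * M
        ≡⟨ cong (_* M) (trans (length-words e (allFin M)) (cong (_^ e) (length-tabulate {n = M} id))) ⟩
      M ^ e * M
        ≡⟨ sym length-cells ⟩
      length cells ∎
      where
      open ≤-Reasoning
      open +-*-Solver
      rs = words e (allFin M)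
      2d+1≤4d : 2 * d + 1 ≤ 4 * d
      2d+1≤4d = begin
        2 * d + 1          ≤⟨ +-monoʳ-≤ (2 * d) (m≤m+n 1 (1 + 2 * e)) ⟩
        2 * d + (2 + 2 * e) ≡⟨ solve 1 (λ e → con 2 :* (con 1 :+ e) :+ (con 2 :+ con 2 :* e)
                                  := con 4 :* (con 1 :+ e)) refl e ⟩
        4 * d              ∎

    -- Each cluster contains enough good cells

    offset+Q≤3dQ : ∀ i j → offset i j + Q ≤ 3 * d * Q
    offset+Q≤3dQ i j = begin
      offset i j + Q        ≤⟨ +-monoˡ-≤ Q (offset≤ (does (i Fin.≟ j))) ⟩
      2 * d * Q + Q         ≤⟨ +-monoʳ-≤ (2 * d * Q) (m≤m+n Q (e * Q)) ⟩
      2 * d * Q + d * Q     ≡⟨ solve 2 (λ d Q → con 2 :* d :* Q :+ d :* Q := con 3 :* d :* Q) refl d Q ⟩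
      3 * d * Q             ∎
      where
      open ≤-Reasoning
      open +-*-Solver
      offset≤ : ∀ b → (if b then 2 * d * Q else 0) ≤ 2 * d * Q
      offset≤ true  = ≤-refl
      offset≤ false = z≤n

    sum-offset : ∀ i → sumᶠ (offset i) ≡ 2 * d * Q
    sum-offset i = sum-indicator i (2 * d * Q)

    -- This accounts for the size of `τ`: over a cluster the last `e` coordinates alone do not
    -- exceed it, so every column of the cluster crosses the threshold from below.
    rest≤τ : ∀ a i {r} → InBox (offset i) Q r → rest a r ≤ τ
    rest≤τ a i {r} r∈ = begin
      rest a r
        ≤⟨ sumᶠ-mono (λ j → *-mono-≤ (tilt≤Q a j) (<⇒≤ (proj₂ (r∈ j)))) ⟩
      sumᶠ (λ j → Q * (offset i j + Q))
        ≡⟨ sumᶠ-*ˡ Q (λ j → offset i j + Q) ⟩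
      Q * sumᶠ (λ j → offset i j + Q)
        ≡⟨ cong (Q *_) (trans (sumᶠ-+ (offset i) (λ _ → Q)) (cong₂ _+_ (sum-offset i) (sumᶠ-const e Q))) ⟩
      Q * (2 * d * Q + e * Q)
        ≤⟨ *-monoʳ-≤ Q (+-monoʳ-≤ (2 * d * Q) (m≤n+m (e * Q) Q)) ⟩
      Q * (2 * d * Q + d * Q)
        ≡⟨ solve 2 (λ d Q → Q :* (con 2 :* d :* Q :+ d :* Q) := con 3 :* d :* Q :* Q) refl d Q ⟩
      τ ∎
      where
      open ≤-Reasoning
      open +-*-Solver

    -- The slab has height `Θ = d * Q` and the score moves in steps of `Q`, so `d` consecutive cells
    -- of the column lie in the slab.
    good-column : ∀ a i r → InBox (offset i) Q r → d ≤ ∑ (allFin M) (λ y → 𝟙 (good? a i (y ∷ r)))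
    good-column a i r r∈ = ∑-tabulate-≥ id (λ y → 𝟙 (good? a i (y ∷ r))) o o+d≤M
      (λ y o≤y y<o+d → ≤-reflexive (sym (𝟙-yes (good? a i (y ∷ r))
         ((above (toℕ y) o≤y , below (toℕ y) y<o+d) , r∈))))
      where
      open ≤-Reasoning
      open +-*-Solver
      c = rest a r
      z = τ ∸ c
      -- Rounding up guarantees `z ≤ Q * o` and overshoots by at most `Q`. The `e` further steps
      -- cost `Q * e`, so the last of the `d` cells still has score at most `τ + Θ`.
      o = suc (z / Q)
      z+c≡τ : z + c ≡ τ
      z+c≡τ = m∸n+n≡m {τ} {c} (rest≤τ a i {r} r∈)
      Q*[o+t]≤ : ∀ t → Q * (o + t) ≤ z + (Q + Q * t)
      Q*[o+t]≤ t = begin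
        Q * (o + t)                  ≡⟨ solve 3 (λ Q o t → Q :* (con 1 :+ o :+ t) := o :* Q :+ (Q :+ Q :* t))
                                          refl Q (z / Q) t ⟩
        z / Q * Q + (Q + Q * t)      ≤⟨ +-monoˡ-≤ (Q + Q * t) (m/n*n≤m z Q) ⟩
        z + (Q + Q * t)              ∎
      -- The window must end inside the column: after multiplication by `Q` it ends at or below
      -- `τ + 2 * (d * Q)`, and `2 ≤ Q` brings this below `Q * M`.
      o+d≤M : o + d ≤ M
      o+d≤M = *-cancelˡ-≤ Q (begin
        Q * (o + d)                     ≤⟨ Q*[o+t]≤ d ⟩
        z + (Q + Q * d)                 ≤⟨ +-mono-≤ (m∸n≤m τ c) (+-monoˡ-≤ (Q * d) (m≤m*n Q d)) ⟩
        τ + (Q * d + Q * d)             ≡⟨ solve 2 (λ Q d → con 3 :* d :* Q :* Q :+ (Q :* d :+ Q :* d)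
                                             := con 3 :* d :* Q :* Q :+ con 2 :* (d :* Q)) refl Q d ⟩
        τ + 2 * (d * Q)                 ≤⟨ +-monoʳ-≤ τ (*-monoˡ-≤ (d * Q) (m≤m*n 2 n)) ⟩
        τ + Q * (d * Q)                 ≡⟨ solve 2 (λ Q d → con 3 :* d :* Q :* Q :+ Q :* (d :* Q)
                                             := Q :* (con 4 :* d :* Q)) refl Q d ⟩
        Q * M                           ∎)
      above : ∀ y → o ≤ y → τ ≤ Q * y + c
      above y o≤y = begin
        τ                       ≡⟨ sym z+c≡τ ⟩
        z + c                   ≤⟨ +-monoˡ-≤ c (<⇒≤ (m<Q+Q*[m/Q] z)) ⟩
        Q + Q * (z / Q) + c     ≡⟨ cong (_+ c) (sym (*-suc Q (z / Q))) ⟩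
        Q * o + c               ≤⟨ +-monoˡ-≤ c (*-monoʳ-≤ Q o≤y) ⟩
        Q * y + c               ∎
      below : ∀ y → y < o + d → Q * y + c ≤ τ + Θ
      below y y<o+d = begin
        Q * y + c               ≤⟨ +-monoˡ-≤ c (*-monoʳ-≤ Q (s≤s⁻¹ (subst (suc y ≤_) (+-suc o e) y<o+d))) ⟩
        Q * (o + e) + c         ≤⟨ +-monoˡ-≤ c (Q*[o+t]≤ e) ⟩
        z + (Q + Q * e) + c     ≡⟨ solve 4 (λ z Q e c → z :+ (Q :+ Q :* e) :+ c := z :+ c :+ (con 1 :+ e) :* Q)
                                     refl z Q e c ⟩
        z + c + Θ               ≡⟨ cong (_+ Θ) z+c≡τ ⟩
        τ + Θ                   ∎

    -- The cluster has at least `Q ^ e` columns, each with `d` good cells.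
    count-good : ∀ a i → Q ^ e * d ≤ count (good? a i) cells
    count-good a i = begin
      Q ^ e * d
        ≤⟨ *-monoˡ-≤ d (count-inBox (offset i) Q (λ j → ≤-trans (offset+Q≤3dQ i j) 3dQ≤M)) ⟩
      count (inBox? (offset i) Q) rs * d
        ≡⟨ sym (∑-*ʳ rs (λ r → 𝟙 (inBox? (offset i) Q r)) d) ⟩
      ∑ rs (λ r → 𝟙 (inBox? (offset i) Q r) * d)
        ≤⟨ ∑-mono rs (λ r → column r (inBox? (offset i) Q r)) ⟩
      ∑ rs (λ r → ∑ (allFin M) (λ y → 𝟙 (good? a i (y ∷ r))))
        ≡⟨ sym (∑-cells (λ x → 𝟙 (good? a i x))) ⟩
      count (good? a i) cells ∎
      where
      open ≤-Reasoning
      rs = words e (allFin M)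
      3dQ≤M : 3 * d * Q ≤ M
      3dQ≤M = *-monoˡ-≤ Q (*-monoˡ-≤ d {3} {4} (m≤m+n 3 1))
      column : ∀ r (r? : Dec (InBox (offset i) Q r)) → 𝟙 r? * d ≤ ∑ (allFin M) (λ y → 𝟙 (good? a i (y ∷ r)))
      column r (yes r∈) = ≤-trans (≤-reflexive (*-identityˡ d)) (good-column a i r r∈)
      column r (no _)   = z≤n

    length-cells≤ : length cells ≤ n * R e * (Q ^ e * d)
    length-cells≤ = ≤-reflexive (begin
      length cells                       ≡⟨ length-cells ⟩
      (4 * d * Q) ^ e * (4 * d * Q)      ≡⟨ cong (_* M) (^-distribʳ-* e (4 * d) Q) ⟩
      (4 * d) ^ e * Q ^ e * M            ≡⟨ solve 4 (λ D q d n → D :* q :* (con 4 :* d :* (con 2 :* n))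
                                              := n :* (con 8 :* D) :* (q :* d)) refl ((4 * d) ^ e) (Q ^ e) d n ⟩
      n * R e * (Q ^ e * d)              ∎)
      where
      open ≡-Reasoning
      open +-*-Solver

    Regular : ∀ {m} → Param → Vec Cell m → Set
    Regular a = Hits (certain? a) (far? a) (good? a) (allFin e)

    regular? : ∀ {m} a → Decidable (Regular {m} a)
    regular? a = hits? (certain? a) (far? a) (good? a) (allFin e)

    count-regular : e + e ≤ n → ∀ a → length cells ^ n ≤ K e * count (regular? a) (words n cells)
    count-regular 2e≤n a = subst
      (λ k → length cells ^ n ≤ 2 * (2 ^ k * k ! * R e ^ k) * count (regular? a) (words n cells))
      (length-tabulate {n = e} id)
      (#hits-constant-fraction (certain? a) (far? a) (good? a)
        (λ {x} → far⇒certain a {x}) (λ i {x} → good⇒certain a i {x}) (λ i {x} → good⇒¬far a i {x})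
        cells (count-good a)
        n (allFin e) (R e) (#near a) {{cells≢0}} (far+near a) (#near-small a) length-cells≤
        (subst (λ k → k + k ≤ n) (sym (length-tabulate {n = e} id)) 2e≤n))
      where
      cells≢0 : NonZero (length cells)
      cells≢0 = subst NonZero (sym length-cells) (m*n≢0 (M ^ e) M {{m^n≢0 M e}})
        where instance
          M≢0 : NonZero M
          M≢0 = m*n≢0 (4 * d) Q

    -- Different regular parameters select different sets

    selection : ∀ {m} → Param → Vec Cell m → Vec Bool m
    selection a = map (λ x → does (τ ≤? score a x))

    -- In a cell of the i-th cluster the i-th coordinate exceeds the others
    -- so much that the score moves with the i-th parameter alone.
    score-gap : ∀ a b i m x → 1 ≤ m → toℕ (lookup a i) ≡ toℕ (lookup b i) + m →
                (∀ j → toℕ (lookup b j) ≤ toℕ (lookup a j) + m) →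
                Good a i x → ¬ τ ≤ score b x
    score-gap a b i m (y ∷ r) 1≤m aᵢ≡bᵢ+m b≤a+m ((_ , sᵃ≤τ+Θ) , r∈) τ≤sᵇ =
      -- The loss of at least `m * (2 * d * Q)` in the i-th coordinate would have to be covered by
      -- the slab height `Θ` and the possible gains `e * (m * Q)`, but it exceeds them by at least
      -- `m * Q`.
      <⇒≱ (m<n+m (m * (d * Q) + e * (m * Q)) {m * Q} (>-nonZero⁻¹ (m * Q) {{m*n≢0 m Q {{>-nonZero 1≤m}}}})) (begin
        m * Q + (m * (d * Q) + e * (m * Q))
          ≡⟨ solve 3 (λ m e Q → m :* Q :+ (m :* ((con 1 :+ e) :* Q) :+ e :* (m :* Q))
               := m :* (con 2 :* (con 1 :+ e) :* Q)) refl m e Q ⟩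
        m * (2 * d * Q)
          ≤⟨ +-cancelˡ-≤ τ _ _ (begin
               τ + m * (2 * d * Q)                 ≤⟨ +-monoˡ-≤ (m * (2 * d * Q)) τ≤sᵇ ⟩
               score b (y ∷ r) + m * (2 * d * Q)   ≤⟨ total ⟩
               score a (y ∷ r) + e * (m * Q)       ≤⟨ +-monoˡ-≤ (e * (m * Q)) sᵃ≤τ+Θ ⟩
               τ + Θ + e * (m * Q)                 ≡⟨ +-assoc τ Θ (e * (m * Q)) ⟩
               τ + (Θ + e * (m * Q))               ∎) ⟩
        Θ + e * (m * Q)
          ≤⟨ +-monoˡ-≤ (e * (m * Q)) (m≤n*m Θ m {{>-nonZero 1≤m}}) ⟩
        m * (d * Q) + e * (m * Q) ∎)
      where
      open ≤-Reasoning
      open +-*-Solver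
      α β ρ : Vector ℕ e
      α j = toℕ (lookup a j)
      β j = toℕ (lookup b j)
      ρ j = toℕ (lookup r j)
      -- In coordinate `i` the tilt drops by `m` at a position of at least `2 * d * Q`; in any other
      -- coordinate it rises by at most `m` at a position below `Q`.
      term : ∀ j → tilt b j * ρ j + m * offset i j ≤ tilt a j * ρ j + m * Q
      term j with i Fin.≟ j | proj₁ (r∈ j) | proj₂ (r∈ j)
      ... | yes refl | o≤ρ | _ = begin
        (n + β i) * ρ i + m * (2 * d * Q)   ≤⟨ +-monoʳ-≤ _ (*-monoʳ-≤ m o≤ρ) ⟩
        (n + β i) * ρ i + m * ρ i           ≡⟨ solve 4 (λ n b r m → (n :+ b) :* r :+ m :* r := (n :+ (b :+ m)) :* r)
                                                 refl n (β i) (ρ i) m ⟩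
        (n + (β i + m)) * ρ i               ≡⟨ cong (λ k → (n + k) * ρ i) (sym aᵢ≡bᵢ+m) ⟩
        (n + α i) * ρ i                     ≤⟨ m≤m+n _ (m * Q) ⟩
        (n + α i) * ρ i + m * Q             ∎
      ... | no _     | _ | ρ<Q = begin
        (n + β j) * ρ j + m * 0             ≡⟨ trans (cong ((n + β j) * ρ j +_) (*-zeroʳ m)) (+-identityʳ _) ⟩
        (n + β j) * ρ j                     ≤⟨ *-monoˡ-≤ (ρ j) (+-monoʳ-≤ n (b≤a+m j)) ⟩
        (n + (α j + m)) * ρ j               ≡⟨ solve 4 (λ n a r m → (n :+ (a :+ m)) :* r := (n :+ a) :* r :+ m :* r)
                                                 refl n (α j) (ρ j) m ⟩
        (n + α j) * ρ j + m * ρ j           ≤⟨ +-monoʳ-≤ _ (*-monoʳ-≤ m (<⇒≤ ρ<Q)) ⟩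
        (n + α j) * ρ j + m * Q             ∎
      total : score b (y ∷ r) + m * (2 * d * Q) ≤ score a (y ∷ r) + e * (m * Q)
      total = begin
        Q * toℕ y + rest b r + m * (2 * d * Q)
          ≡⟨ +-assoc (Q * toℕ y) (rest b r) _ ⟩
        Q * toℕ y + (rest b r + m * (2 * d * Q))
          ≡⟨ cong (λ k → Q * toℕ y + (rest b r + k))
               (trans (cong (m *_) (sym (sum-offset i))) (sym (sumᶠ-*ˡ m (offset i)))) ⟩
        Q * toℕ y + (rest b r + sumᶠ (λ j → m * offset i j))
          ≡⟨ cong (Q * toℕ y +_) (sym (sumᶠ-+ (λ j → tilt b j * ρ j) (λ j → m * offset i j))) ⟩
        Q * toℕ y + sumᶠ (λ j → tilt b j * ρ j + m * offset i j)
          ≤⟨ +-monoʳ-≤ (Q * toℕ y) (sumᶠ-mono term) ⟩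
        Q * toℕ y + sumᶠ (λ j → tilt a j * ρ j + m * Q)
          ≡⟨ cong (Q * toℕ y +_) (trans (sumᶠ-+ (λ j → tilt a j * ρ j) (λ _ → m * Q))
               (cong (rest a r +_) (sumᶠ-const e (m * Q)))) ⟩
        Q * toℕ y + (rest a r + e * (m * Q))
          ≡⟨ sym (+-assoc (Q * toℕ y) (rest a r) _) ⟩
        Q * toℕ y + rest a r + e * (m * Q) ∎

    -- Regularity of `a` provides an object in its i-th good region. This object is selected by `a`,
    -- and `score-gap` keeps `b` from selecting it.
    selections-differ : ∀ {m} {w : Vec Cell m} a b i k → 1 ≤ k → toℕ (lookup a i) ≡ toℕ (lookup b i) + k →
                        (∀ j → toℕ (lookup b j) ≤ toℕ (lookup a j) + k) →
                        Regular a w → selection a w ≢ selection b w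
    selections-differ {w = w} a b i k 1≤k aᵢ≡bᵢ+k b≤a+k (_ , hits) Sᵃ≡Sᵇ
      with any-map-≡ {f = λ x → does (τ ≤? score a x)} {g = λ x → does (τ ≤? score b x)}
             (ListAll.lookup hits (∈-allFin i)) Sᵃ≡Sᵇ
    ... | x@(_ ∷ _) , good@((τ≤sᵃ , _) , _) , same = score-gap a b i k x 1≤k aᵢ≡bᵢ+k b≤a+k good
          (does-true (τ ≤? score b x) (trans (sym same) (dec-true (τ ≤? score a x) τ≤sᵃ)))

    -- It suffices to treat an index where the difference is largest. With no coordinates there is
    -- no such index, but then the vectors are equal anyway.
    no-max⇒≡ : ∀ {e} (a b : Vec (Fin n) e) →
      (∀ i → (∀ j → ∣ toℕ (lookup a j) - toℕ (lookup b j) ∣ ≤ ∣ toℕ (lookup a i) - toℕ (lookup b i) ∣) →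
         ∣ toℕ (lookup a i) - toℕ (lookup b i) ∣ ≡ 0) → a ≡ b
    no-max⇒≡ {zero}  [] [] _ = refl
    no-max⇒≡ {suc e} a  b  f with argmax (λ j → ∣ toℕ (lookup a j) - toℕ (lookup b j) ∣)
    ... | i , max = lookup-injective (λ j → toℕ-injective
          (∣m-n∣≡0⇒m≡n (n≤0⇒n≡0 (subst (_ ≤_) (f i max) (max j)))))

    -- At an index of largest difference, the parameter with the larger entry has an object there
    -- that the other one does not select. Either of the two may be the larger, so both have to be
    -- regular.
    selection-injective : ∀ {m} {w : Vec Cell m} {a b} → Regular a w → Regular b w →
                          selection a w ≡ selection b w → a ≡ b
    selection-injective {w = w} {a} {b} regᵃ regᵇ Sᵃ≡Sᵇ = no-max⇒≡ a b zero-gap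
      where
      α β δ : Vector ℕ e
      α j = toℕ (lookup a j)
      β j = toℕ (lookup b j)
      δ j = ∣ α j - β j ∣
      zero-gap : ∀ i → (∀ j → δ j ≤ δ i) → δ i ≡ 0
      zero-gap i max with δ i ≟ 0
      ... | yes δ≡0 = δ≡0
      ... | no δ≢0 with ≤-total (α i) (β i)
      ...   | inj₁ aᵢ≤bᵢ = contradiction (sym Sᵃ≡Sᵇ) (selections-differ b a i (δ i) (n≢0⇒n>0 δ≢0)
                (trans (sym (m+[n∸m]≡n aᵢ≤bᵢ)) (cong (α i +_) (sym (m≤n⇒∣m-n∣≡n∸m aᵢ≤bᵢ))))
                (λ j → ≤-trans (m≤n+∣m-n∣ (α j) (β j)) (+-monoʳ-≤ (β j) (max j))) regᵇ)
      ...   | inj₂ bᵢ≤aᵢ = contradiction Sᵃ≡Sᵇ (selections-differ a b i (δ i) (n≢0⇒n>0 δ≢0)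
                (trans (sym (m+[n∸m]≡n bᵢ≤aᵢ)) (cong (β i +_) (sym (m≤n⇒∣n-m∣≡n∸m bᵢ≤aᵢ))))
                (λ j → ≤-trans (m≤n+∣n-m∣ (β j) (α j)) (+-monoʳ-≤ (α j) (max j))) regᵃ)

-- Grid boxes, their volumes and integrals of step functions

module Grid where
  open import Data.Bool using (true; false)
  open import Data.Fin using (Fin; zero; suc; toℕ)
  open import Data.Fin.Properties as Fin using (toℕ<n; toℕ-injective)
  open import Data.List as List using (List; []; _∷_; length; filter; allFin)
  open import Data.List.Properties using (length-map; length-tabulate)
  open import Data.List.Relation.Unary.All as ListAll using ([]; _∷_)
  open import Data.List.Relation.Unary.All.Properties using (all-filter)
  import Data.List.Relation.Unary.All.Properties as ListAll
  open import Data.List.Relation.Unary.AllPairs as AllPairs using (AllPairs; []; _∷_)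
  import Data.List.Relation.Unary.AllPairs.Properties as AllPairs
  open import Data.List.Relation.Unary.Unique.Propositional using (Unique)
  open import Data.List.Relation.Unary.Unique.Propositional.Properties
    using (allFin⁺; cartesianProductWith⁺; filter⁺)
  open import Data.Nat as ℕ using (ℕ; zero; suc)
  import Data.Nat.Properties as ℕ
  open import Data.Product using (_,_; proj₁; proj₂; ∃-syntax)
  open import Data.Rational
  open import Data.Rational.Properties
  open import Data.Rational.Solver using (module +-*-Solver)
  open import Data.Sum using (_⊎_; inj₁; inj₂; map)
  open import Data.Vec using (Vec; []; _∷_; lookup)
  open import Data.Vec.Functional using (Vector)
  open import Data.Vec.Properties using (∷-injective; ≡-dec; lookup-map)
  open import Data.Vec.Relation.Unary.All.Properties using (lookup⁺)
  open import Function using (_∘_; id)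
  open import Relation.Binary.Definitions using (DecidableEquality; tri<; tri≈; tri>)
  open import Relation.Binary.PropositionalEquality
  open import Relation.Nullary using (¬_; yes; no; does; contradiction)
  open import Relation.Unary using (Pred)
  open import Level using (0ℓ)
  open import Algebra.Bundles using (CommutativeRing)
  open import Algebra.Properties.Semiring.Sum (CommutativeRing.semiring +-*-commutativeRing)
    using (sum; sum-cong-≗; *-distribʳ-sum)
  open Counting
  open Embedding
  open Certificate
  open Thresholds

  lookup-differs : ∀ {A : Set} {m} → DecidableEquality A → {v w : Vec A m} →
                   v ≢ w → ∃[ j ] lookup v j ≢ lookup w j
  lookup-differs _≟_ {[]}     {[]}     v≢w = contradiction refl v≢w
  lookup-differs _≟_ {x ∷ v} {y ∷ w} v≢w with x ≟ y
  ... | no x≢y   = zero , x≢y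
  ... | yes refl with lookup-differs _≟_ {v} {w} (v≢w ∘ cong (x ∷_))
  ...   | j , vⱼ≢wⱼ = suc j , vⱼ≢wⱼ

  unique-map : ∀ {A B : Set} {P : Pred A 0ℓ} {f : A → B} →
               (∀ {x y} → P x → P y → f x ≡ f y → x ≡ y) →
               ∀ {xs} → ListAll.All P xs → Unique xs → Unique (List.map f xs)
  unique-map inj []         []          = []
  unique-map inj (px ∷ pxs) (x∉xs ∷ xs!) =
    ListAll.map⁺ (ListAll.zipWith (λ { (py , x≢y) → x≢y ∘ inj px py }) (pxs , x∉xs)) ∷ unique-map inj pxs xs!

  ∏-const : ∀ m {c} k → c * fromℕ k ≡ 1ℚ → ∏ {m} (λ _ → c) * fromℕ (k ℕ.^ m) ≡ 1ℚ
  ∏-const zero    k ck≡1 = refl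
  ∏-const (suc m) {c} k ck≡1 = begin
    c * p * fromℕ (k ℕ.* k ℕ.^ m)              ≡⟨ cong (c * p *_) (fromℕ-* k (k ℕ.^ m)) ⟩
    c * p * (fromℕ k * fromℕ (k ℕ.^ m))        ≡⟨ solve 4 (λ c p k l → c :* p :* (k :* l) := (c :* k) :* (p :* l))
                                                    refl c p (fromℕ k) (fromℕ (k ℕ.^ m)) ⟩
    (c * fromℕ k) * (p * fromℕ (k ℕ.^ m))      ≡⟨ cong₂ _*_ ck≡1 (∏-const m k ck≡1) ⟩
    1ℚ                                         ∎
    where
    open ≡-Reasoning
    open +-*-Solver
    p = ∏ {m} (λ _ → c)

  ∏-nonNeg : ∀ m c → NonNegative c → NonNegative (∏ {m} (λ _ → c))
  ∏-nonNeg zero    c c≥0 = _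
  ∏-nonNeg (suc m) c c≥0 =
    nonNeg*nonNeg⇒nonNeg c {{c≥0}} (∏ {m} (λ _ → c)) {{∏-nonNeg m c c≥0}}

  ∏-cong : ∀ {m} {f g : Vector ℚ m} → (∀ i → f i ≡ g i) → ∏ f ≡ ∏ g
  ∏-cong {zero}  f≡g = refl
  ∏-cong {suc m} f≡g = cong₂ _*_ (f≡g zero) (∏-cong (f≡g ∘ suc))

  sum-fromℕ : ∀ {m} (f : Vector ℕ m) → sum (fromℕ ∘ f) ≡ fromℕ (sumᶠ f)
  sum-fromℕ {zero}  f = refl
  sum-fromℕ {suc m} f = trans (cong (fromℕ (f zero) +_) (sum-fromℕ (f ∘ suc))) (sym (fromℕ-+ (f zero) _))

  integral-map : ∀ {d n} {A : Set} (B : A → Box d n) (k : A → ℕ) V → (∀ x → volume (B x) ≡ V) →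
                 ∀ xs dis → integral (List.map (λ x → B x , k x) xs , dis) ≡ fromℕ (∑ xs k) * V
  integral-map B k V vol []       dis       = sym (*-zeroˡ V)
  integral-map B k V vol (x ∷ xs) (_ ∷ dis) = begin
    fromℕ (k x) * volume (B x) + integral (List.map (λ x → B x , k x) xs , dis)
      ≡⟨ cong₂ _+_ (cong (fromℕ (k x) *_) (vol x)) (integral-map B k V vol xs dis) ⟩
    fromℕ (k x) * V + fromℕ (∑ xs k) * V
      ≡⟨ sym (*-distribʳ-+ V (fromℕ (k x)) (fromℕ (∑ xs k))) ⟩
    (fromℕ (k x) + fromℕ (∑ xs k)) * V
      ≡⟨ cong (_* V) (sym (fromℕ-+ (k x) (∑ xs k))) ⟩
    fromℕ (k x ℕ.+ ∑ xs k) * V ∎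
    where open ≡-Reasoning

  module _ (M : ℕ) .{{_ : ℕ.NonZero M}} where

    private
      instance
        M>0 : Positive (fromℕ M)
        M>0 = fromℕ-positive M

    -- The mesh width of the grid.
    ι : ℚ
    ι = (1/ fromℕ M) {{pos⇒nonZero (fromℕ M)}}

    instance
      ι>0 : Positive ι
      ι>0 = 1/pos⇒pos (fromℕ M)

    ι*M≡1 : ι * fromℕ M ≡ 1ℚ
    ι*M≡1 = *-inverseˡ (fromℕ M) {{pos⇒nonZero (fromℕ M)}}

    *ι-mono : ∀ k l → k ℕ.≤ l → fromℕ k * ι ≤ fromℕ l * ι
    *ι-mono k l k≤l = *-monoʳ-≤-nonNeg ι {{pos⇒nonNeg ι}} (fromℕ-mono-≤ k≤l)

    gridBox : ∀ {d n} → Vec (Vec (Fin M) d) n → Box d n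
    gridBox w .lo i j = fromℕ (toℕ (lookup (lookup w j) i)) * ι
    gridBox w .hi i j = fromℕ (suc (toℕ (lookup (lookup w j) i))) * ι
    gridBox w .0≤lo i j = ≤-trans (≤-reflexive (sym (*-zeroˡ ι))) (*ι-mono 0 (toℕ (lookup (lookup w j) i)) ℕ.z≤n)
    gridBox w .lo≤hi i j = *ι-mono (toℕ (lookup (lookup w j) i)) (suc (toℕ (lookup (lookup w j) i))) (ℕ.n≤1+n _)
    gridBox w .hi≤1 i j = ≤-trans (*ι-mono (suc (toℕ (lookup (lookup w j) i))) M (toℕ<n (lookup (lookup w j) i)))
      (≤-reflexive (trans (*-comm (fromℕ M) ι) ι*M≡1))

    gridBox-nonOverlapping : ∀ {d n} {w w′ : Vec (Vec (Fin M) d) n} → w ≢ w′ →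
                             NonOverlapping (gridBox w) (gridBox w′)
    gridBox-nonOverlapping {w = w} {w′} w≢w′ =
      let j , wⱼ≢w′ⱼ = lookup-differs (≡-dec Fin._≟_) {w} {w′} w≢w′
          i , ≢ = lookup-differs Fin._≟_ {lookup w j} {lookup w′ j} wⱼ≢w′ⱼ
          x = λ (w : Vec (Vec (Fin M) _) _) → toℕ (lookup (lookup w j) i)
      in i , j , map (*ι-mono (suc (x w)) (x w′)) (*ι-mono (suc (x w′)) (x w)) (compare (≢ ∘ toℕ-injective))
      where
      compare : ∀ {k l} → k ≢ l → suc k ℕ.≤ l ⊎ suc l ℕ.≤ k
      compare {k} {l} k≢l with ℕ.<-cmp k l
      ... | tri< k<l _ _ = inj₁ k<l
      ... | tri≈ _ k≡l _ = contradiction k≡l k≢l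
      ... | tri> _ _ l<k = inj₂ l<k

    gridVolume : ℕ → ℕ → ℚ
    gridVolume d n = ∏ {d} (λ _ → ∏ {n} (λ _ → ι))

    gridVolume-nonNeg : ∀ d n → NonNegative (gridVolume d n)
    gridVolume-nonNeg d n = ∏-nonNeg d (∏ {n} (λ _ → ι)) (∏-nonNeg n ι (pos⇒nonNeg ι))

    volume-gridBox : ∀ {d n} (w : Vec (Vec (Fin M) d) n) → volume (gridBox w) ≡ gridVolume d n
    volume-gridBox w = ∏-cong (λ i → ∏-cong (λ j → side (toℕ (lookup (lookup w j) i))))
      where
      open +-*-Solver
      side : ∀ k → fromℕ (suc k) * ι - fromℕ k * ι ≡ ι
      side k = trans (cong (λ q → q * ι - fromℕ k * ι) (fromℕ-+ 1 k))
        (solve 2 (λ k i → (con 1ℚ :+ k) :* i :- k :* i := i) refl (fromℕ k) ι)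

    gridVolume-inverse : ∀ d n → gridVolume d n * fromℕ ((M ℕ.^ d) ℕ.^ n) ≡ 1ℚ
    gridVolume-inverse d n = trans (cong (λ k → gridVolume d n * fromℕ k) swap)
      (∏-const d (M ℕ.^ n) (∏-const n M ι*M≡1))
      where
      -- Words are counted object by object, whereas the volume is a product over profits first.
      swap : (M ℕ.^ d) ℕ.^ n ≡ (M ℕ.^ n) ℕ.^ d
      swap = trans (ℕ.^-*-assoc M d n) (trans (cong (M ℕ.^_) (ℕ.*-comm d n)) (sym (ℕ.^-*-assoc M n d)))

  -- A simple function below the number of Pareto-optimal solutions

  module _ (n e : ℕ) .{{n≢0 : ℕ.NonZero n}} where

    private
      m = M n e
      D = d n e

      instance
        m≢0 : ℕ.NonZero m
        m≢0 = ℕ.m*n≢0 (4 ℕ.* D) (Q n e) {{_}} {{Q≢0 n e}}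

    value-fromℕ : ∀ {k} (c : Vector ℕ k) (f : Vector ℕ k) →
      sum (λ i → fromℕ (c i) * (fromℕ (f i) * ι m)) ≡ fromℕ (sumᶠ (λ i → c i ℕ.* f i)) * ι m
    value-fromℕ c f = begin
      sum (λ i → fromℕ (c i) * (fromℕ (f i) * ι m))
        ≡⟨ sum-cong-≗ (λ i → trans (sym (*-assoc (fromℕ (c i)) (fromℕ (f i)) (ι m)))
             (cong (_* ι m) (sym (fromℕ-* (c i) (f i))))) ⟩
      sum (λ i → fromℕ (c i ℕ.* f i) * ι m)
        ≡⟨ sym (*-distribʳ-sum (ι m) (λ i → fromℕ (c i ℕ.* f i))) ⟩
      sum (λ i → fromℕ (c i ℕ.* f i)) * ι m
        ≡⟨ cong (_* ι m) (sum-fromℕ (λ i → c i ℕ.* f i)) ⟩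
      fromℕ (sumᶠ (λ i → c i ℕ.* f i)) * ι m ∎
      where open ≡-Reasoning

    -- Every cell is certain. A selected object has score at least `τ` already at the lower corner
    -- of its cell. For the others `score + Θ` is below `τ`, and going to the upper corner adds the
    -- sum of the coefficients, which is at most `Θ`.
    regular⇒paretoOptimal : ∀ {a} {w : Vec (Cell n e) n} → Regular n e a w →
      ∀ v → v ∈ᴮ gridBox m w → ParetoOptimal (unitWeightKnapsack v) (selection n e a w)
    regular⇒paretoOptimal {a} {w} (certain , _) v v∈B =
      threshold-paretoOptimal (gridBox m w) c t c>0 t>0 (selection n e a w) in-above out-below v v∈B
      where
      open ≤-Reasoning
      c : Vector ℚ D
      c i = fromℕ (coefficient n e a i)
      -- Scores count in units of the mesh width, hence so does the threshold.
      t = fromℕ (τ n e) * ι m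
      c>0 : ∀ i → Positive (c i)
      c>0 zero    = fromℕ-positive (Q n e) {{Q≢0 n e}}
      c>0 (suc j) = fromℕ-positive (tilt n e a j) {{ℕ.>-nonZero (ℕ.≤-trans (ℕ.>-nonZero⁻¹ n) (ℕ.m≤m+n n _))}}
      t>0 : Positive t
      t>0 = pos*pos⇒pos (fromℕ (τ n e)) {{fromℕ-positive (τ n e)
        {{ℕ.m*n≢0 (3 ℕ.* D ℕ.* Q n e) (Q n e) {{ℕ.m*n≢0 (3 ℕ.* D) (Q n e) {{_}} {{Q≢0 n e}}}} {{Q≢0 n e}}}}}}
        (ι m) {{ι>0 m}}
      x : Fin n → Cell n e
      x j = lookup w j
      selected : ∀ j → lookup (selection n e a w) j ≡ does (τ n e ℕ.≤? score n e a (x j))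
      selected j = lookup-map j (λ x → does (τ n e ℕ.≤? score n e a x)) w
      in-above : ∀ j → lookup (selection n e a w) j ≡ true → t ≤ value (lo (gridBox m w)) c j
      in-above j Sⱼ = ≤-trans (*ι-mono m (τ n e) (score n e a (x j)) (does-true (τ n e ℕ.≤? score n e a (x j)) (trans (sym (selected j)) Sⱼ)))
        (≤-reflexive (sym (value-fromℕ (coefficient n e a) (λ i → toℕ (lookup (x j) i)))))
      upper-score : ∀ j → sumᶠ (λ i → coefficient n e a i ℕ.* suc (toℕ (lookup (x j) i)))
                            ≡ sumᶠ (coefficient n e a) ℕ.+ score n e a (x j)
      upper-score j = trans (sumᶠ-cong (λ i → ℕ.*-suc (coefficient n e a i) (toℕ (lookup (x j) i))))
        (sumᶠ-+ (coefficient n e a) (λ i → coefficient n e a i ℕ.* toℕ (lookup (x j) i)))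
      out-below : ∀ j → lookup (selection n e a w) j ≡ false → value (hi (gridBox m w)) c j ≤ t
      out-below j Sⱼ = ≤-trans
        (≤-reflexive (value-fromℕ (coefficient n e a) (λ i → suc (toℕ (lookup (x j) i)))))
        (*ι-mono m (sumᶠ (λ i → coefficient n e a i ℕ.* suc (toℕ (lookup (x j) i)))) (τ n e) (ℕ.≤-trans (ℕ.≤-reflexive (upper-score j))
          (below (lookup⁺ certain j)
            (does-false (τ n e ℕ.≤? score n e a (x j)) (trans (sym (selected j)) Sⱼ)))))
        where
        below : Certain n e a (x j) → ¬ τ n e ℕ.≤ score n e a (x j) →
                sumᶠ (coefficient n e a) ℕ.+ score n e a (x j) ℕ.≤ τ n e
        below (inj₁ s+Θ<τ) _ = ℕ.≤-trans (ℕ.+-monoˡ-≤ (score n e a (x j)) (sum-coefficient≤Θ n e a))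
          (ℕ.≤-trans (ℕ.≤-reflexive (ℕ.+-comm (Θ n e) (score n e a (x j)))) (ℕ.<⇒≤ s+Θ<τ))
        below (inj₂ τ≤s) τ≰s = contradiction τ≤s τ≰s

    params : List (Param n e)
    params = words e (allFin n)

    regularParams : Vec (Cell n e) n → List (Param n e)
    regularParams w = filter (λ a → regular? n e a w) params

    atLeast-regular : ∀ w v → v ∈ᴮ gridBox m w → #Pareto D n (length (regularParams w)) v
    atLeast-regular w v v∈B =
      List.map (λ a → selection n e a w) (regularParams w) ,
      length-map _ (regularParams w) ,
      unique-map (selection-injective n e) regulars
        (filter⁺ (λ a → regular? n e a w) (words-unique e (allFin⁺ n))) ,
      ListAll.map⁺ (ListAll.map (λ {a} reg → regular⇒paretoOptimal {a} {w} reg v v∈B) regulars)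
      where
      regulars : ListAll.All (λ a → Regular n e a w) (regularParams w)
      regulars = all-filter (λ a → regular? n e a w) params

    grid : List (Vec (Cell n e) n)
    grid = words n (cells n e)

    grid-unique : Unique grid
    grid-unique = words-unique n (cartesianProductWith⁺ (λ r y → y ∷ r)
      (λ eq → proj₂ (∷-injective eq) , proj₁ (∷-injective eq))
      (words-unique e (allFin⁺ m)) (allFin⁺ m))

    simple : SimpleFunction D n
    simple = List.map (λ w → gridBox m w , length (regularParams w)) grid ,
             AllPairs.map⁺ (AllPairs.map (gridBox-nonOverlapping m) grid-unique)

    simple-below : simple Below #Pareto D n
    simple-below = ListAll.map⁺ (ListAll.universal atLeast-regular grid)

    total : ℕ
    total = ∑ grid (λ w → length (regularParams w))

    integral-simple : integral simple ≡ fromℕ total * gridVolume m D n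
    integral-simple = integral-map (gridBox m) (λ w → length (regularParams w)) (gridVolume m D n)
      (volume-gridBox m) grid (proj₂ simple)

    -- Linearity of expectation as double counting: each of the `n ^ e` parameters is regular on a
    -- fixed fraction of the grid, and exchanging the sums counts the regular parameters of each
    -- grid box.
    n^e*T^n≤K*total : e ℕ.+ e ℕ.≤ n → n ℕ.^ e ℕ.* (m ℕ.^ D) ℕ.^ n ℕ.≤ K e ℕ.* total
    n^e*T^n≤K*total 2e≤n = begin
      n ℕ.^ e ℕ.* (m ℕ.^ D) ℕ.^ n
        ≡⟨ cong₂ (λ k l → k ℕ.* l ℕ.^ n) (sym length-params)
             (trans (ℕ.*-comm m (m ℕ.^ e)) (sym (length-cells n e))) ⟩
      length params ℕ.* length (cells n e) ℕ.^ n
        ≡⟨ sym (∑-const params _) ⟩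
      ∑ params (λ _ → length (cells n e) ℕ.^ n)
        ≤⟨ ∑-mono params (count-regular n e 2e≤n) ⟩
      ∑ params (λ a → K e ℕ.* count (regular? n e a) grid)
        ≡⟨ ∑-*ˡ params (K e) (λ a → count (regular? n e a) grid) ⟩
      K e ℕ.* ∑ params (λ a → ∑ grid (λ w → 𝟙 (regular? n e a w)))
        ≡⟨ cong (K e ℕ.*_) (∑-comm params grid (λ a w → 𝟙 (regular? n e a w))) ⟩
      K e ℕ.* ∑ grid (λ w → ∑ params (λ a → 𝟙 (regular? n e a w)))
        ≡⟨ cong (K e ℕ.*_) (∑-cong grid (λ w → sym (length-filter≡count (λ a → regular? n e a w) params))) ⟩
      K e ℕ.* total ∎
      where
      open ℕ.≤-Reasoning
      length-params : length params ≡ n ℕ.^ e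
      length-params = trans (length-words e (allFin n)) (cong (ℕ._^ e) (length-tabulate {n = n} id))

    n^e≤K*integral : e ℕ.+ e ℕ.≤ n → fromℕ (n ℕ.^ e) ≤ fromℕ (K e) * integral simple
    n^e≤K*integral 2e≤n = begin
      N                                   ≡⟨ sym (*-identityʳ N) ⟩
      N * 1ℚ                              ≡⟨ cong (N *_) (sym (gridVolume-inverse m D n)) ⟩
      N * (V * fromℕ T)                   ≡⟨ solve 3 (λ N V T → N :* (V :* T) := (N :* T) :* V) refl N V (fromℕ T) ⟩
      N * fromℕ T * V                     ≡⟨ cong (_* V) (sym (fromℕ-* (n ℕ.^ e) T)) ⟩
      fromℕ (n ℕ.^ e ℕ.* T) * V           ≤⟨ *-monoʳ-≤-nonNeg V {{gridVolume-nonNeg m D n}} (fromℕ-mono-≤ (n^e*T^n≤K*total 2e≤n)) ⟩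
      fromℕ (K e ℕ.* total) * V         ≡⟨ cong (_* V) (fromℕ-* (K e) total) ⟩
      fromℕ (K e) * fromℕ total * V     ≡⟨ *-assoc (fromℕ (K e)) (fromℕ total) V ⟩
      fromℕ (K e) * (fromℕ total * V)   ≡⟨ cong (fromℕ (K e) *_) (sym integral-simple) ⟩
      fromℕ (K e) * integral simple     ∎
      where
      open ≤-Reasoning
      open +-*-Solver
      N = fromℕ (n ℕ.^ e)
      T = (m ℕ.^ D) ℕ.^ n
      V = gridVolume m D n

  -- Comparison of powers and the asymptotic bound

  -- With d = e + 1 the claim is n^(e - 1/2) ≤ n^e. If `p` were at least n^e, then p² n³ would be at
  -- least n^(2e+3), which is no less than n^(2d) = n^(2e+2).
  power-bound : ∀ n e {p} → .{{ℕ.NonZero n}} → (n ^[ suc e -3/2]) p → p < fromℕ (n ℕ.^ e)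
  power-bound n e (inj₁ p<0) = <-≤-trans p<0 (nonNegative⁻¹ _ {{fromℕ-nonNegative (n ℕ.^ e)}})
  power-bound n e {p} (inj₂ p²n³<n²ᵈ) = ≰⇒> λ N≤p → <-irrefl refl (begin-strict
    fromℕ (n ℕ.^ (2 ℕ.* suc e))
      ≤⟨ fromℕ-mono-≤ power ⟩
    fromℕ (n ℕ.^ e ℕ.* n ℕ.^ e ℕ.* n ℕ.^ 3)
      ≡⟨ trans (fromℕ-* (n ℕ.^ e ℕ.* n ℕ.^ e) (n ℕ.^ 3)) (cong (_* fromℕ (n ℕ.^ 3)) (fromℕ-* (n ℕ.^ e) (n ℕ.^ e))) ⟩
    N * N * fromℕ (n ℕ.^ 3)
      ≤⟨ *-monoʳ-≤-nonNeg (fromℕ (n ℕ.^ 3)) {{fromℕ-nonNegative (n ℕ.^ 3)}} (≤-trans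
           (*-monoˡ-≤-nonNeg N {{fromℕ-nonNegative (n ℕ.^ e)}} N≤p)
           (*-monoʳ-≤-nonNeg p {{nonNegative (≤-trans (nonNegative⁻¹ N {{fromℕ-nonNegative (n ℕ.^ e)}}) N≤p)}} N≤p)) ⟩
    p * p * fromℕ (n ℕ.^ 3)
      <⟨ p²n³<n²ᵈ ⟩
    fromℕ (n ℕ.^ (2 ℕ.* suc e)) ∎)
    where
    open ≤-Reasoning
    N = fromℕ (n ℕ.^ e)
    power : n ℕ.^ (2 ℕ.* suc e) ℕ.≤ n ℕ.^ e ℕ.* n ℕ.^ e ℕ.* n ℕ.^ 3
    power = ℕ.≤-trans (ℕ.^-monoʳ-≤ n exponents) (ℕ.≤-reflexive
      (trans (ℕ.^-distribˡ-+-* n (e ℕ.+ e) 3) (cong (ℕ._* n ℕ.^ 3) (ℕ.^-distribˡ-+-* n e e))))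
      where
      open import Data.Nat.Solver renaming (module +-*-Solver to ℕ-Solver)
      open ℕ-Solver
      exponents : 2 ℕ.* suc e ℕ.≤ e ℕ.+ e ℕ.+ 3
      exponents = ℕ.≤-trans (ℕ.n≤1+n _) (ℕ.≤-reflexive
        (solve 1 (λ e → con 1 :+ con 2 :* (con 1 :+ e) := e :+ e :+ con 3) refl e))

  lowerBound : ∀ e → (λ n → 𝔼 (#Pareto (suc e) n)) ∈Ω (λ n → n ^[ suc e -3/2])
  -- The constant is 1 / K. Starting at 2e + 1 ensures both `e + e ≤ n` and that `n` is not 0.
  lowerBound e = c , positive⁻¹ c , suc (e ℕ.+ e) , bound
    where
    k = K e
    instance
      k>0 : Positive (fromℕ k)
      k>0 = fromℕ-positive k {{K≢0 e}}
    c = (1/ fromℕ k) {{pos⇒nonZero (fromℕ k)}}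
    instance
      c>0 : Positive c
      c>0 = 1/pos⇒pos (fromℕ k)
    bound : ∀ n → suc (e ℕ.+ e) ℕ.≤ n → c ⊛ (n ^[ suc e -3/2]) ≤ᴸ 𝔼 (#Pareto (suc e) n)
    bound n@(suc _) n≥ {q} (p , p<n^[d-3/2] , q≡cp) = simple n e , simple-below n e , (begin-strict
      q                                              ≡⟨ q≡cp ⟩
      c * p                                          <⟨ *-monoʳ-<-pos c (power-bound n e p<n^[d-3/2]) ⟩
      c * fromℕ (n ℕ.^ e)                       ≤⟨ *-monoˡ-≤-nonNeg c {{pos⇒nonNeg c}}
                                                          (n^e≤K*integral n e (ℕ.<⇒≤ n≥)) ⟩
      c * (fromℕ k * integral (simple n e))     ≡⟨ sym (*-assoc c (fromℕ k) _) ⟩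
      c * fromℕ k * integral (simple n e)       ≡⟨ cong (_* integral (simple n e))
                                                          (*-inverseˡ (fromℕ k) {{pos⇒nonZero (fromℕ k)}}) ⟩
      1ℚ * integral (simple n e)                     ≡⟨ *-identityˡ _ ⟩
      integral (simple n e)                          ∎)
      where open ≤-Reasoning

open import Data.Nat using (ℕ; _≤_; suc)

theorem3 : (d : ℕ) → 1 ≤ d → (λ n → 𝔼 (#Pareto d n)) ∈Ω (λ n → n ^[ d -3/2])
theorem3 (suc e) _ = Grid.lowerBound e
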